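{- There is a static data structure (called recrank) which, for every ordered set $S\subset\{0,1,\ldots,n-1\}$ with $m\ge 1$ elements, stores a representation of $S$ in $1.44\,m\log_2\frac{n}{m}+m+o(n)$ bits in the worst case, and which, on the word RAM, answers each query $\mathrm{rank}(x,S)$ in $O(1+\log\frac{n}{m})$ worst-case time and each query $\mathrm{select}(i,S)$ in $O(1+\log\frac{n}{m})$ worst-case time.
   Context: For $S\subset\{0,1,\ldots,n-1\}$: $\mathrm{rank}(x,S)$ is the number of elements of $S$ which are no greater than $x$, and $\mathrm{select}(i,S)$ is the $i$-th smallest element of $S$. Word RAM model: logical and arithmetic operations on two $O(\log n)$-bit integers take constant time, and any consecutive $O(\log n)$ bits of memory at any address can be read or written in constant time. The term $o(n)$ is as $n\to\infty$. -}

module Defs where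

open import Data.Bool using (Bool; true; false; if_then_else_; _∧_; _∨_; _xor_)
open import Data.Fin using (Fin; zero; suc; toℕ; _≤?_)
open import Data.Fin.Subset using (Subset; inside; outside; ∣_∣; _∩_)
open import Data.List using (List; []; _∷_; length; lookup)
open import Data.Maybe using (Maybe; just; nothing)
open import Data.Nat
  using (ℕ; zero; suc; _+_; _*_; _∸_; _^_; _⊓_; _/_; _%_; _≤_; _<_; _≡ᵇ_; _≤ᵇ_; _<ᵇ_)
open import Data.Nat.Logarithm using (⌊log₂_⌋)
open import Data.Nat.Properties using (m^n≢0)
open import Data.Product using (∃-syntax; _×_)
open import Data.Vec as Vec using (tabulate)
open import Relation.Binary.PropositionalEquality using (_≡_)
open import Relation.Nullary using (does)

rank : ∀ {n} → Fin n → Subset n → ℕ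
rank x S = ∣ S ∩ tabulate (λ y → does (y ≤? x)) ∣

-- The index is 0-based: the i-th smallest element of S, 1 ≤ i ≤ ∣ S ∣, is
-- select S j for the j with i = suc (toℕ j).
select : ∀ {n} (S : Subset n) → Fin ∣ S ∣ → Fin n
select (inside  Vec.∷ S) zero    = zero
select (inside  Vec.∷ S) (suc j) = suc (select S j)
select (outside Vec.∷ S) j       = suc (select S j)

-- A word RAM with w-bit words.  Words are natural numbers below 2 ^ w, and bit
-- i has weight 2 ^ i.  Memory is bit-addressed, and one instruction may read or
-- write any block of at most w consecutive bits.

bit : ℕ → ℕ → Bool
bit x i = (_/_ x (2 ^ i) {{m^n≢0 2 i}}) % 2 ≡ᵇ 1

fromBits : ℕ → (ℕ → Bool) → ℕ
fromBits zero    f = 0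
fromBits (suc k) f = fromBits k f + (if f k then 2 ^ k else 0)

truncate : ℕ → ℕ → ℕ
truncate w x = _%_ x (2 ^ w) {{m^n≢0 2 w}}

data Op : Set where
  ADD SUB MUL DIV MOD AND OR XOR SHL SHR : Op

-- Arithmetic is modulo 2 ^ w; dividing by 0, or taking a remainder by 0,
-- gives 0.
evalOp : ℕ → Op → ℕ → ℕ → ℕ
evalOp w ADD x y       = truncate w (x + y)
evalOp w SUB x y       = truncate w (x + 2 ^ w ∸ y)
evalOp w MUL x y       = truncate w (x * y)
evalOp w DIV x zero    = 0
evalOp w DIV x (suc y) = x / suc y
evalOp w MOD x zero    = 0
evalOp w MOD x (suc y) = x % suc y
evalOp w AND x y       = fromBits w (λ i → bit x i ∧ bit y i)
evalOp w OR  x y       = fromBits w (λ i → bit x i ∨ bit y i)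
evalOp w XOR x y       = fromBits w (λ i → bit x i xor bit y i)
evalOp w SHL x y       = truncate w (x * 2 ^ y)
evalOp w SHR x y       = fromBits w (λ i → bit x (i + y))

Register : Set
Register = ℕ

-- load d a k : d ← the block of (contents of k) bits at address (contents of a)
-- store s a k : the low (contents of k) bits of s are written at address
--                (contents of a)
-- jumpLess a b l : go to instruction l if (contents of a) < (contents of b)
-- Block lengths above w are cut down to w.
data Instruction : Set where
  const    : (d : Register) (v : ℕ) → Instruction
  op       : Op → (d a b : Register) → Instruction
  load     : (d a k : Register) → Instruction
  store    : (s a k : Register) → Instruction
  jump     : (l : ℕ) → Instruction
  jumpLess : (a b : Register) (l : ℕ) → Instruction

Program : Set
Program = List Instruction

fetch : Program → ℕ → Maybe Instruction
fetch []      _       = nothing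
fetch (i ∷ p) zero    = just i
fetch (i ∷ p) (suc l) = fetch p l

Memory : Set
Memory = ℕ → Bool

record State : Set where
  constructor state
  field
    pc   : ℕ
    regs : Register → ℕ
    mem  : Memory

open State public

setReg : Register → ℕ → (Register → ℕ) → (Register → ℕ)
setReg d v r e = if e ≡ᵇ d then v else r e

readBlock : Memory → (address len : ℕ) → ℕ
readBlock μ a k = fromBits k (λ i → μ (a + i))

writeBlock : Memory → (address len value : ℕ) → Memory
writeBlock μ a k v j =
  if (a ≤ᵇ j) ∧ (j <ᵇ a + k) then bit v (j ∸ a) else μ j

execute : ℕ → Instruction → State → State
execute w (const d v)  (state l r μ) = state (suc l) (setReg d (truncate w v) r) μ
execute w (op o d a b) (state l r μ) = state (suc l) (setReg d (evalOp w o (r a) (r b)) r) μ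
execute w (load d a k) (state l r μ) = state (suc l) (setReg d (readBlock μ (r a) (r k ⊓ w)) r) μ
execute w (store s a k) (state l r μ) = state (suc l) r (writeBlock μ (r a) (r k ⊓ w) (r s))
execute w (jump l′)    (state l r μ) = state l′ r μ
execute w (jumpLess a b l′) (state l r μ) =
  state (if r a <ᵇ r b then l′ else suc l) r μ

-- w , p ⊢ s ⇓[ t ] s′ : from s the program halts in s′ after exactly t
-- instructions.  A program halts when pc points outside it.
data _,_⊢_⇓[_]_ (w : ℕ) (p : Program) : State → ℕ → State → Set where
  halt : ∀ {s} → fetch p (pc s) ≡ nothing → w , p ⊢ s ⇓[ 0 ] s
  step : ∀ {s i t s′} → fetch p (pc s) ≡ just i →
         w , p ⊢ execute w i s ⇓[ t ] s′ → w , p ⊢ s ⇓[ suc t ] s′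

-- Words have wordFactor * (1 + ⌊log₂ n⌋) = Θ(log n) bits.  The constant
-- wordFactor and both programs are the same for all n and S; everything that
-- depends on n or S, the number n included, has to be read from the encoding.
record StaticStructure : Set where
  field
    wordFactor    : ℕ
    0<wordFactor  : 0 < wordFactor
    encode        : ∀ n → Subset n → List Bool
    rankProgram   : Program
    selectProgram : Program

  wordSize : ℕ → ℕ
  wordSize n = wordFactor * suc ⌊log₂ n ⌋

Holds : Memory → List Bool → Set
Holds μ bits = ∀ (i : Fin (length bits)) → μ (toℕ i) ≡ lookup bits i

initial : ℕ → Memory → State
initial query μ = state 0 (setReg 0 query (λ _ → 0)) μ

-- Query and answer are passed in register 0.  Memory outside the encoding is
-- scratch space with arbitrary initial contents.  The encoding itself must be
-- intact at the end, so that queries can be asked in any sequence.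
Answers : (w : ℕ) → Program → List Bool → (query answer : ℕ) → (ℕ → Set) → Set
Answers w p bits query answer TimeBound =
  ∀ (μ : Memory) → Holds μ bits →
  ∃[ t ] ∃[ s ] ( w , p ⊢ initial query μ ⇓[ t ] s
                × regs s 0 ≡ answer
                × Holds (mem s) bits
                × TimeBound t )

-- For n , m ≥ 1 this is the real inequality  a ≤ b + c · log₂ (n / m),
-- exponentiated and cleared of the denominator m ^ c.
_atMost_plus_·log₂[_/_] : (a b c n m : ℕ) → Set
a atMost b plus c ·log₂[ n / m ] = 2 ^ a * m ^ c ≤ 2 ^ b * n ^ c

infix 4 _atMost_plus_·log₂[_/_]

-- e(n) = o(n): for every k, e(n) ≤ n / k for all large n.
LittleO[n] : (ℕ → ℕ) → Set
LittleO[n] e = ∀ k → ∃[ N ] (∀ n → N ≤ n → k * e n ≤ n)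

-- bits ≤ 1.44 · m · log₂ (n / m) + m + e, multiplied by 25 (1.44 = 36 / 25).
SpaceBound : (n m e bits : ℕ) → Set
SpaceBound n m e bits =
  25 * bits atMost 25 * (m + e) plus 36 * m ·log₂[ n / m ]

-- t ≤ C · (1 + log₂ (n / m))
QueryTimeBound : (C n m t : ℕ) → Set
QueryTimeBound C n m t = t atMost C plus C ·log₂[ n / m ]

{-# OPTIONS --safe #-}
module Submission where

-- Cut the universe into blocks of b ≈ (log n)/8 positions and store each block
-- by its number k of ones and its index among the b C k blocks with k ones, in
-- 1 + ⌊log₂ (b C k)⌋ bits.  Since (b C k) xᵏ yᵇ⁻ᵏ ≤ (x + y)ᵇ for all x and y,
-- the codes of all blocks take at most m log₂ ((x+y)/x) + (n-m) log₂ ((x+y)/y)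
-- + o(n) bits.  With x = y this is n, which suffices for n ≤ 3m; with x = m and
-- y = n - m it is at most m log₂ (n/m) + m log₂ 3, which suffices for n ≥ 3m.
--
-- Rank needs a two-level directory (superblocks of log² n blocks) of the number
-- of ones and of the code position before each block, and a table of all blocks.
-- For select, the ones are grouped by log n loglog n, and the superblock of the
-- first one in each group is stored.  A group that leaves the superblock it
-- starts in is determined by that superblock, so explicit answers for it fit in
-- a row of an array indexed by superblocks.  Groups of (loglog n)² ones lead
-- from superblocks to blocks in the same way.  Hence both queries take constant
-- time, and both programs can be branch-free.

open import Defs
open import Data.Bool using (Bool; true; false; if_then_else_; T; _∧_)
open import Data.Bool.Properties using (T-≡; ∧-identityʳ; ∧-zeroʳ)
open import Data.Empty using (⊥-elim)
open import Data.Fin as Fin using (Fin; zero; suc; fromℕ<; toℕ)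
open import Data.Fin.Properties using (toℕ-fromℕ<; toℕ<n)
open import Data.Fin.Subset using (Subset; inside; outside; ∣_∣; _∩_)
open import Data.Fin.Subset.Properties using (∣p∣≤n)
open import Data.List using (List; []; _∷_; _++_; length; lookup; foldl; applyUpTo)
open import Data.List.Properties using (foldl-++; length-applyUpTo; lookup-applyUpTo)
open import Data.List.Relation.Unary.All using (All; []; _∷_)
import Data.List.Relation.Unary.All.Properties as All
open import Data.Nat hiding (_≤?_)
open import Data.Nat.Combinatorics using (nCn≡1; nCk+nC[k+1]≡[n+1]C[k+1]) renaming (_C_ to _choose_)
open import Data.Nat.Divisibility using (n∣m*n)
open import Data.Nat.DivMod
  using (m≡m%n+[m/n]*n; m%n<n; m%n≤m; n%1≡0; m<n⇒m%n≡m; [m+n]%n≡m%n; [m+kn]%n≡m%n; m∣n⇒o%n%m≡o%m;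
         m%[n*o]/o≡m/o%n; m/n≤m; m/n<m; m/n*n≤m; m*n/n≡m; m<n⇒m/n≡0; m≥n⇒m/n>0; m<n*o⇒m/o<n; /-monoˡ-≤;
         +-distrib-/-∣ˡ)
open import Data.Nat.Induction using (<-rec)
open import Data.Nat.Logarithm using (⌊log₂_⌋; ⌊log₂⌋-mono-≤; ⌊log₂⌊n/2⌋⌋≡⌊log₂n⌋∸1)
open import Data.Nat.Properties
open import Data.Nat.Tactic.RingSolver using (solve-∀)
open import Data.Product using (_×_; _,_; proj₁; proj₂; Σ-syntax; ∃-syntax)
open import Data.Sum using (inj₁; inj₂; [_,_]′)
open import Data.Vec as Vec using ([]; _∷_; tabulate)
open import Data.Vec.Properties using (tabulate-cong)
open import Function using (_∘_)
open import Function.Bundles using (Equivalence)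
open import Relation.Binary.PropositionalEquality
open import Relation.Nullary using (does; contradiction)

-- The space bound is a real inequality, but the proof stays in ℕ: inequalities between logarithms
-- become inequalities between products of powers, and a probability x/(x+y) is represented by
-- natural weights x and y. At n = 3m both estimates have room. Below, n ≤ m + 1.44 m log₂ (n/m)
-- holds because log₂ is concave: both sides are m at n = m, and at n = 3m the claim is 2 ≤ 1.44
-- log₂ 3. Above, m log₂ 3 - m ≤ 0.44 m log₂ (n/m), already at n = 3m. Every segment other than the
-- stream of codes takes O(n / loglog n) bits, which governs the block, superblock and group sizes.
-- The programs are the same for all n, and even the word size is unknown to them; hence the
-- parameters and the segment addresses are kept in a header. Without jumps, the time is the length
-- of the program and correctness reduces to the value of an expression. The price is that both
-- alternatives of every choice are evaluated, and the discarded one may read meaningless addresses.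

-- Expressions and their compilation to straight-line programs

data Expr : Set where
  #_    : ℕ → Expr
  query : Expr
  calc  : Op → Expr → Expr → Expr
  read  : (address len : Expr) → Expr

-- The machine has no move instruction, so the query is copied by adding 0 to it; this is why its
-- value passes through `evalOp w ADD`.
eval : (w : ℕ) → Memory → (input : ℕ) → Expr → ℕ
eval w μ x (# v)        = truncate w v
eval w μ x query        = evalOp w ADD x (truncate w 0)
eval w μ x (calc o a b) = evalOp w o (eval w μ x a) (eval w μ x b)
eval w μ x (read a k)   = readBlock μ (eval w μ x a) (eval w μ x k ⊓ w)

-- Register 0 keeps the query, registers 1, …, d ∸ 1 hold pending operands.
compile : Expr → (d : Register) → Program
compile (# v)        d = const d v ∷ []
compile query        d = const d 0 ∷ op ADD d 0 d ∷ []
compile (calc o a b) d = compile a d ++ compile b (suc d) ++ op o d d (suc d) ∷ []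
compile (read a k)   d = compile a d ++ compile k (suc d) ++ load d d (suc d) ∷ []

program : Expr → Program
program e = compile e 1 ++ const 2 0 ∷ op ADD 0 1 2 ∷ []

Advances : Instruction → Set
Advances i = ∀ w s → pc (execute w i s) ≡ suc (pc s)

compile-advances : ∀ e d → All Advances (compile e d)
compile-advances (# v)        d = (λ _ _ → refl) ∷ []
compile-advances query        d = (λ _ _ → refl) ∷ (λ _ _ → refl) ∷ []
compile-advances (calc o a b) d =
  All.++⁺ (compile-advances a d) (All.++⁺ (compile-advances b (suc d)) ((λ _ _ → refl) ∷ []))
compile-advances (read a k)   d =
  All.++⁺ (compile-advances a d) (All.++⁺ (compile-advances k (suc d)) ((λ _ _ → refl) ∷ []))

run : ℕ → Program → State → State
run w p s = foldl (λ s i → execute w i s) s p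

-- Induction on the part `p` of `P` still to be executed, which the second hypothesis locates at the
-- current `pc`. The time depends on neither memory nor query; this is the source of the constant
-- query time.
straight-line : ∀ {w P} p {s} → All Advances p → (∀ k → fetch P (pc s + k) ≡ fetch p k) →
                w , P ⊢ s ⇓[ length p ] run w p s
straight-line {P = P} [] {s} [] at =
  halt (trans (cong (fetch P) (sym (+-identityʳ (pc s)))) (at 0))
straight-line {w} {P} (i ∷ p) {s} (adv ∷ advs) at =
  step (trans (cong (fetch P) (sym (+-identityʳ (pc s)))) (at 0))
    (straight-line p advs λ k →
      trans (cong (fetch P) (trans (cong (_+ k) (adv w s)) (sym (+-suc (pc s) k)))) (at (suc k)))

≡ᵇ-refl : ∀ d → (d ≡ᵇ d) ≡ true
≡ᵇ-refl d = Equivalence.to T-≡ (≡⇒≡ᵇ d d refl)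

setReg-same : ∀ d v r → setReg d v r d ≡ v
setReg-same d v r rewrite ≡ᵇ-refl d = refl

setReg-other : ∀ {d e} v r → e ≢ d → setReg d v r e ≡ r e
setReg-other {d} {e} v r e≢d with e ≡ᵇ d in eq
... | false = refl
... | true  = ⊥-elim (e≢d (≡ᵇ⇒≡ e d (Equivalence.from T-≡ eq)))

-- `keeps` protects the query in register 0 and the first operand of a binary operation while the
-- second is computed one register higher. `memory` is what leaves the encoding intact for later
-- queries.
record Computes (e : Expr) (d : Register) (w : ℕ) (s s′ : State) : Set where
  field
    result : regs s′ d ≡ eval w (mem s) (regs s 0) e
    keeps  : ∀ {r} → r < d → regs s′ r ≡ regs s r
    memory : mem s′ ≡ mem s

open Computes

run-++ : ∀ w p q s → run w (p ++ q) s ≡ run w q (run w p s)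
run-++ w p q s = foldl-++ (λ s i → execute w i s) s p q

compile-correct : ∀ e {d} w s → 0 < d → Computes e d w s (run w (compile e d) s)

compile-binary : ∀ {w d s} a b i → 0 < d →
  ∃[ s₂ ] run w (compile a d ++ compile b (suc d) ++ i ∷ []) s ≡ execute w i s₂ ×
    regs s₂ d ≡ eval w (mem s) (regs s 0) a ×
    regs s₂ (suc d) ≡ eval w (mem s) (regs s 0) b ×
    (∀ {r} → r < d → regs s₂ r ≡ regs s r) × mem s₂ ≡ mem s
compile-binary {w} {d} {s} a b i 0<d =
  s₂ , trans (run-++ w (compile a d) _ s) (run-++ w (compile b (suc d)) _ s₁)
     , trans (keeps C₂ (n<1+n d)) (result C₁)
     , trans (result C₂) (cong₂ (λ μ x → eval w μ x b) (memory C₁) (keeps C₁ 0<d))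
     , (λ r<d → trans (keeps C₂ (m<n⇒m<1+n r<d)) (keeps C₁ r<d))
     , trans (memory C₂) (memory C₁)
  where
  s₁ = run w (compile a d) s
  s₂ = run w (compile b (suc d)) s₁
  C₁ = compile-correct a w s 0<d
  C₂ = compile-correct b w s₁ z<s

compile-correct (# v) {d} w s 0<d = record
  { result = setReg-same d _ (regs s)
  ; keeps  = λ r<d → setReg-other _ (regs s) (<⇒≢ r<d)
  ; memory = refl }
compile-correct query {d} w s 0<d = record
  { result = trans (setReg-same d _ zeroed)
      (cong₂ (evalOp w ADD) (setReg-other _ (regs s) (<⇒≢ 0<d)) (setReg-same d _ (regs s)))
  ; keeps  = λ r<d → trans (setReg-other _ zeroed (<⇒≢ r<d)) (setReg-other _ (regs s) (<⇒≢ r<d))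
  ; memory = refl }
  where zeroed = setReg d (truncate w 0) (regs s)
compile-correct (calc o a b) {d} w s 0<d
  with s₂ , eq , ra , rb , kp , mm ← compile-binary {w} {d} {s} a b (op o d d (suc d)) 0<d
  rewrite eq = record
  { result = trans (setReg-same d _ (regs s₂)) (cong₂ (evalOp w o) ra rb)
  ; keeps  = λ r<d → trans (setReg-other _ (regs s₂) (<⇒≢ r<d)) (kp r<d)
  ; memory = mm }
compile-correct (read a k) {d} w s 0<d
  with s₂ , eq , ra , rk , kp , mm ← compile-binary {w} {d} {s} a k (load d d (suc d)) 0<d
  rewrite eq = record
  { result = trans (setReg-same d _ (regs s₂))
      (trans (cong (λ μ → readBlock μ (regs s₂ d) (regs s₂ (suc d) ⊓ w)) mm)
        (cong₂ (λ x l → readBlock (mem s) x (l ⊓ w)) ra rk))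
  ; keeps  = λ r<d → trans (setReg-other _ (regs s₂) (<⇒≢ r<d)) (kp r<d)
  ; memory = mm }

program-answers : ∀ {w bits x answer TimeBound} e → TimeBound (length (program e)) →
  (∀ μ → Holds μ bits → eval w μ x e ≡ answer) → answer < 2 ^ w →
  Answers w (program e) bits x answer TimeBound
program-answers {w} {bits} {x} {answer} e time correct answer<2^w μ holds =
  _ , s₃ , straight-line (program e) (All.++⁺ (compile-advances e 1) ((λ _ _ → refl) ∷ (λ _ _ → refl) ∷ []))
             (λ _ → refl)
    , trans (cong (λ s → regs s 0) split)
        (trans (cong₂ (λ a z → truncate w (a + z)) value (m<n⇒m%n≡m (m^n>0 2 w)))
          (trans (cong (truncate w) (+-identityʳ answer)) (m<n⇒m%n≡m answer<2^w)))
    , (λ i → trans (cong (λ s → mem s (toℕ i)) split) (trans (cong (λ m → m (toℕ i)) (memory C)) (holds i)))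
    , time
  where
  instance _ = m^n≢0 2 w
  s₀ = initial x μ
  s₁ = run w (compile e 1) s₀
  s₃ = run w (program e) s₀
  C : Computes e 1 w s₀ s₁
  C = compile-correct e w s₀ z<s
  value : regs s₁ 1 ≡ answer
  value = trans (result C) (correct μ holds)
  split : s₃ ≡ run w (const 2 0 ∷ op ADD 0 1 2 ∷ []) s₁
  split = run-++ w (compile e 1) _ s₀

<ᵇ-true : ∀ {m n} → m < n → (m <ᵇ n) ≡ true
<ᵇ-true m<n = Equivalence.to T-≡ (<⇒<ᵇ m<n)

<ᵇ-false : ∀ {m n} → n ≤ m → (m <ᵇ n) ≡ false
<ᵇ-false {m} {n} n≤m with m <ᵇ n in eq
... | false = refl
... | true  = ⊥-elim (≤⇒≯ n≤m (<ᵇ⇒< m n (Equivalence.from T-≡ eq)))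

-- Words as bit strings

fromBits-cong : ∀ k {f g : ℕ → Bool} → (∀ {i} → i < k → f i ≡ g i) → fromBits k f ≡ fromBits k g
fromBits-cong zero    eq = refl
fromBits-cong (suc k) eq =
  cong₂ _+_ (fromBits-cong k (eq ∘ m<n⇒m<1+n)) (cong (λ b → if b then 2 ^ k else 0) (eq (n<1+n k)))

if-odd : ∀ r p → r < 2 → (if r ≡ᵇ 1 then p else 0) ≡ r * p
if-odd 0 p _ = refl
if-odd 1 p _ = sym (+-identityʳ p)
if-odd (suc (suc r)) p (s≤s (s≤s ()))

fromBits-bit-% : ∀ k v → fromBits k (bit v) ≡ truncate k v
fromBits-bit-% zero    v = sym (n%1≡0 v)
fromBits-bit-% (suc k) v = begin
  fromBits k (bit v) + (if bit v k then p else 0) ≡⟨ cong₂ _+_ (fromBits-bit-% k v) (if-odd (v / p % 2) p (m%n<n (v / p) 2)) ⟩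
  v % p + v / p % 2 * p ≡⟨ cong₂ (λ x y → x + y * p) (sym (m∣n⇒o%n%m≡o%m p (2 * p) v (n∣m*n 2)))
        (sym (m%[n*o]/o≡m/o%n v 2 p)) ⟩
  v % (2 * p) % p + v % (2 * p) / p * p ≡⟨ m≡m%n+[m/n]*n (v % (2 * p)) p ⟨
  v % (2 * p) ∎
  where
  open ≡-Reasoning
  p = 2 ^ k
  instance
    _ = m^n≢0 2 k
    _ = m^n≢0 2 (suc k)

truncate-small : ∀ w {x} → x < 2 ^ w → truncate w x ≡ x
truncate-small w x<2^w = m<n⇒m%n≡m {{m^n≢0 2 w}} x<2^w

readBlock-value : ∀ μ a k {v} → (∀ {t} → t < k → μ (a + t) ≡ bit v t) → v < 2 ^ k → readBlock μ a k ≡ v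
readBlock-value μ a k {v} eq v<2^k =
  trans (fromBits-cong k eq) (trans (fromBits-bit-% k v) (truncate-small k v<2^k))

n<2^n : ∀ n → n < 2 ^ n
n<2^n zero    = s≤s z≤n
n<2^n (suc n) = begin-strict
  suc n         ≤⟨ n<2^n n ⟩
  2 ^ n         <⟨ m<m+n (2 ^ n) (≤-trans (m^n>0 2 n) (m≤m+n _ 0)) ⟩
  2 ^ suc n     ∎
  where open ≤-Reasoning

-- Values of expressions in the absence of overflow

module Evaluation (w : ℕ) (μ : Memory) (x : ℕ) where

  infix 4 _⇒_
  record _⇒_ (e : Expr) (v : ℕ) : Set where
    constructor eval≡
    field evaluates : eval w μ x e ≡ v

  open _⇒_ public

  infixl 1 _as_
  _as_ : ∀ {e u v} → e ⇒ u → u ≡ v → e ⇒ v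
  eval≡ p as q = eval≡ (trans p q)

  #⇒ : ∀ {v} → v < 2 ^ w → # v ⇒ v
  #⇒ v< = eval≡ (truncate-small w v<)

  query⇒ : x < 2 ^ w → query ⇒ x
  query⇒ x< = eval≡ (trans (cong (λ z → truncate w (x + z)) (truncate-small w (m^n>0 2 w)))
                (trans (cong (truncate w) (+-identityʳ x)) (truncate-small w x<)))

  add⇒ : ∀ {a b u v} → a ⇒ u → b ⇒ v → u + v < 2 ^ w → calc ADD a b ⇒ u + v
  add⇒ (eval≡ refl) (eval≡ refl) v< = eval≡ (truncate-small w v<)

  mul⇒ : ∀ {a b u v} → a ⇒ u → b ⇒ v → u * v < 2 ^ w → calc MUL a b ⇒ u * v
  mul⇒ (eval≡ refl) (eval≡ refl) v< = eval≡ (truncate-small w v<)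

  sub⇒ : ∀ {a b u v} → a ⇒ u → b ⇒ v → v ≤ u → u < 2 ^ w → calc SUB a b ⇒ u ∸ v
  sub⇒ {u = u} {v} (eval≡ refl) (eval≡ refl) v≤u u< = eval≡
    (trans (cong (truncate w) (+-∸-comm (2 ^ w) v≤u))
      (trans ([m+n]%n≡m%n (u ∸ v) (2 ^ w) {{m^n≢0 2 w}})
             (truncate-small w (≤-<-trans (m∸n≤m u v) u<))))

  div⇒ : ∀ {a b u v} .{{_ : NonZero v}} → a ⇒ u → b ⇒ v → calc DIV a b ⇒ u / v
  div⇒ {a} {v = suc v} (eval≡ refl) (eval≡ eq) = eval≡ (cong (evalOp w DIV (eval w μ x a)) eq)

  mod⇒ : ∀ {a b u v} .{{_ : NonZero v}} → a ⇒ u → b ⇒ v → calc MOD a b ⇒ u % v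
  mod⇒ {a} {v = suc v} (eval≡ refl) (eval≡ eq) = eval≡ (cong (evalOp w MOD (eval w μ x a)) eq)

  read⇒ : ∀ {a k u l v} → a ⇒ u → k ⇒ l → l ≤ w → (∀ {t} → t < l → μ (u + t) ≡ bit v t) → v < 2 ^ l →
          read a k ⇒ v
  read⇒ {u = u} {l} (eval≡ refl) (eval≡ refl) l≤w eq v< =
    eval≡ (trans (cong (readBlock μ u) (m≤n⇒m⊓n≡m l≤w)) (readBlock-value μ u l eq v<))

  -- Nothing is assumed of `b`: it will be the discarded alternative of a choice, whose value can be
  -- anything.
  0*⇒ : ∀ {a b} → a ⇒ 0 → calc MUL a b ⇒ 0
  0*⇒ {b = b} (eval≡ eq) =
    eval≡ (trans (cong (λ z → truncate w (z * eval w μ x b)) eq) (truncate-small w (m^n>0 2 w)))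

-- Prefix sums and concatenation

psum : (ℕ → ℕ) → ℕ → ℕ
psum f zero    = 0
psum f (suc k) = psum f k + f k

psum-mono : ∀ f {i j} → i ≤ j → psum f i ≤ psum f j
psum-mono f {i} {zero}  z≤n = z≤n
psum-mono f {i} {suc j} i≤1+j with m≤n⇒m<n∨m≡n i≤1+j
... | inj₁ (s≤s i≤j) = ≤-trans (psum-mono f i≤j) (m≤m+n _ (f j))
... | inj₂ refl      = ≤-refl

psum-+ : ∀ f a k → psum f (a + k) ≡ psum f a + psum (f ∘ (a +_)) k
psum-+ f a zero    = trans (cong (psum f) (+-identityʳ a)) (sym (+-identityʳ _))
psum-+ f a (suc k) =
  trans (cong (psum f) (+-suc a k))
    (trans (cong (_+ f (a + k)) (psum-+ f a k)) (+-assoc (psum f a) _ _))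

psum-cong : ∀ {f g} k → (∀ {i} → i < k → f i ≡ g i) → psum f k ≡ psum g k
psum-cong zero    eq = refl
psum-cong (suc k) eq = cong₂ _+_ (psum-cong k (eq ∘ m<n⇒m<1+n)) (eq (n<1+n k))

psum-bound : ∀ {f c} k → (∀ i → f i ≤ c) → psum f k ≤ k * c
psum-bound {f} {c} zero    le = z≤n
psum-bound {f} {c} (suc k) le = ≤-trans (+-mono-≤ (psum-bound k le) (le k)) (≤-reflexive (+-comm (k * c) c))

psum-const : ∀ c k → psum (λ _ → c) k ≡ k * c
psum-const c zero    = refl
psum-const c (suc k) = trans (cong (_+ c) (psum-const c k)) (+-comm (k * c) c)

concat : (len : ℕ → ℕ) (f : ℕ → ℕ → Bool) → ℕ → (ℕ → Bool)
concat len f zero    j = false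
concat len f (suc k) j = if j <ᵇ psum len k then concat len f k j else f k (j ∸ psum len k)

concat-bit : ∀ len f {K k t} → k < K → t < len k → concat len f K (psum len k + t) ≡ f k t
concat-bit len f {suc K} {k} {t} (s≤s k≤K) t< with m≤n⇒m<n∨m≡n k≤K
... | inj₁ k<K rewrite <ᵇ-true (≤-trans (+-monoʳ-< (psum len k) t<) (psum-mono len k<K)) = concat-bit len f k<K t<
... | inj₂ refl rewrite <ᵇ-false (m≤m+n (psum len k) t) = cong (f k) (m+n∸m≡n (psum len k) t)

indicator : Bool → ℕ
indicator b = if b then 1 else 0

count : (ℕ → Bool) → ℕ → ℕ
count χ = psum (indicator ∘ χ)

indicator≤1 : ∀ b → indicator b ≤ 1
indicator≤1 false = z≤n
indicator≤1 true  = ≤-refl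

count≤ : ∀ χ k → count χ k ≤ k
count≤ χ k = ≤-trans (psum-bound k (indicator≤1 ∘ χ)) (≤-reflexive (*-identityʳ k))

-- The number of y < N with count χ (suc y) ≤ i, which is the position of the
-- i-th one of χ, counted from 0, whenever i < count χ N.
position : (ℕ → Bool) → ℕ → ℕ → ℕ
position χ zero    i = 0
position χ (suc N) i = if i <ᵇ count χ (suc N) then position χ N i else suc N

module _ (χ : ℕ → Bool) where

  position-≤ : ∀ N i → position χ N i ≤ N
  position-≤ zero    i = z≤n
  position-≤ (suc N) i with i <ᵇ count χ (suc N)
  ... | true  = m≤n⇒m≤1+n (position-≤ N i)
  ... | false = ≤-refl

  position-< : ∀ N {i z} → i < count χ z → position χ N i < z
  position-< zero    {z = suc z} _ = s≤s z≤n
  position-< (suc N) {i} {z} i< with i <ᵇ count χ (suc N) in eq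
  ... | true  = position-< N i<
  ... | false = ≰⇒> λ z≤1+N → contradiction
    (trans (sym (<ᵇ-true (≤-trans i< (psum-mono (indicator ∘ χ) z≤1+N)))) eq) λ ()

  position-≥ : ∀ N {i z} → z ≤ N → count χ z ≤ i → z ≤ position χ N i
  position-≥ zero    z≤n _ = z≤n
  position-≥ (suc N) {i} {z} z≤1+N ≤i with m≤n⇒m<n∨m≡n z≤1+N
  ... | inj₂ refl rewrite <ᵇ-false ≤i = ≤-refl
  ... | inj₁ (s≤s z≤N) with i <ᵇ count χ (suc N)
  ...   | true  = position-≥ N z≤N ≤i
  ...   | false = m≤n⇒m≤1+n z≤N

  position-unique : ∀ {N i y} → y < N → count χ y ≤ i → i < count χ (suc y) → position χ N i ≡ y
  position-unique {N} y<N ≤i i< =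
    ≤-antisym (≤-pred (position-< N i<)) (position-≥ N (<⇒≤ y<N) ≤i)

  count-position : ∀ N i → count χ (position χ N i) ≤ i
  count-position N i = ≮⇒≥ λ i< → <-irrefl refl (position-< N i<)

  count-position-suc : ∀ {N i} → i < count χ N → i < count χ (suc (position χ N i))
  count-position-suc {N} i< = ≰⇒> λ ≤i → 1+n≰n (position-≥ N (position-< N i<) ≤i)

  position-mono : ∀ N {i j} → i ≤ j → position χ N i ≤ position χ N j
  position-mono N i≤j = position-≥ N (position-≤ N _) (≤-trans (count-position N _) i≤j)

-- Subsets as bit sequences

-- The value `false` beyond the universe pads the last block with zeros.
member : ∀ {n} → Subset n → ℕ → Bool
member []      _       = false
member (s ∷ S) zero    = s
member (s ∷ S) (suc y) = member S y

count-member-∷ : ∀ {n} s (S : Subset n) y →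
                 count (member (s ∷ S)) (suc y) ≡ indicator s + count (member S) y
count-member-∷ s S y = psum-+ (indicator ∘ member (s ∷ S)) 1 y

size-count : ∀ {n} (S : Subset n) → ∣ S ∣ ≡ count (member S) n
size-count []                   = refl
size-count {suc n} (inside ∷ S)  = trans (cong suc (size-count S)) (sym (count-member-∷ inside S n))
size-count {suc n} (outside ∷ S) = trans (size-count S) (sym (count-member-∷ outside S n))

∩-empty : ∀ {n} (S : Subset n) → ∣ S ∩ tabulate (λ _ → false) ∣ ≡ 0
∩-empty []      = refl
∩-empty (s ∷ S) rewrite ∧-zeroʳ s = ∩-empty S

size-∷ : ∀ {n} s (S : Subset n) → ∣ s ∷ S ∣ ≡ indicator s + ∣ S ∣
size-∷ inside  S = refl
size-∷ outside S = refl

≤?-suc : ∀ {n} (y x : Fin n) → does (suc y Fin.≤? suc x) ≡ does (y Fin.≤? x)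
≤?-suc zero    x = refl
≤?-suc (suc y) x = refl

rank-count : ∀ {n} (x : Fin n) (S : Subset n) → rank x S ≡ count (member S) (suc (toℕ x))
rank-count zero (s ∷ S) rewrite ∧-identityʳ s = begin
  ∣ s ∷ (S ∩ tabulate (λ _ → false)) ∣ ≡⟨ size-∷ s (S ∩ tabulate (λ _ → false)) ⟩
  indicator s + ∣ S ∩ tabulate (λ _ → false) ∣ ≡⟨ cong (indicator s +_) (∩-empty S) ⟩
  indicator s + 0 ≡⟨ count-member-∷ s S 0 ⟨
  count (member (s ∷ S)) 1 ∎
  where open ≡-Reasoning
rank-count (suc x) (s ∷ S) rewrite ∧-identityʳ s = begin
  ∣ s ∷ (S ∩ tabulate (λ y → does (suc y Fin.≤? suc x))) ∣ ≡⟨ size-∷ s (S ∩ tabulate (λ y → does (suc y Fin.≤? suc x))) ⟩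
  indicator s + ∣ S ∩ tabulate (λ y → does (suc y Fin.≤? suc x)) ∣
    ≡⟨ cong (λ T → indicator s + ∣ S ∩ T ∣) (tabulate-cong (λ y → ≤?-suc y x)) ⟩
  indicator s + rank x S ≡⟨ cong (indicator s +_) (rank-count x S) ⟩
  indicator s + count (member S) (suc (toℕ x)) ≡⟨ count-member-∷ s S _ ⟨
  count (member (s ∷ S)) (suc (suc (toℕ x))) ∎
  where open ≡-Reasoning

-- With `select-upper`, these are the hypotheses under which `position-unique` identifies `select`
-- with `position`.
select-lower : ∀ {n} (S : Subset n) j → count (member S) (toℕ (select S j)) ≤ toℕ j
select-lower (inside ∷ S)  zero    = z≤n
select-lower (inside ∷ S)  (suc j) =
  ≤-trans (≤-reflexive (count-member-∷ inside S (toℕ (select S j)))) (s≤s (select-lower S j))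
select-lower (outside ∷ S) j       =
  ≤-trans (≤-reflexive (count-member-∷ outside S (toℕ (select S j)))) (select-lower S j)

select-upper : ∀ {n} (S : Subset n) j → toℕ j < count (member S) (suc (toℕ (select S j)))
select-upper (inside ∷ S)  zero    = ≤-refl
select-upper (inside ∷ S)  (suc j) =
  ≤-trans (s≤s (select-upper S j)) (≤-reflexive (sym (count-member-∷ inside S (suc (toℕ (select S j))))))
select-upper (outside ∷ S) j       =
  ≤-trans (select-upper S j) (≤-reflexive (sym (count-member-∷ outside S (suc (toℕ (select S j))))))

log₂-bounds : ∀ n → 1 ≤ n → 2 ^ ⌊log₂ n ⌋ ≤ n × n < 2 ^ suc ⌊log₂ n ⌋
log₂-bounds = <-rec _ go
  where
  go : ∀ n → (∀ {m} → m < n → 1 ≤ m → 2 ^ ⌊log₂ m ⌋ ≤ m × m < 2 ^ suc ⌊log₂ m ⌋) →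
       1 ≤ n → 2 ^ ⌊log₂ n ⌋ ≤ n × n < 2 ^ suc ⌊log₂ n ⌋
  go 1 _ _ = ≤-refl , ≤-refl
  go n@(suc (suc n′)) ih _ = subst (λ l → 2 ^ l ≤ n × n < 2 ^ suc l) (sym log-n) (lower , upper)
    where
    open ≤-Reasoning
    h = ⌊ n /2⌋
    lₕ = ⌊log₂ h ⌋
    ihₕ = ih (⌊n/2⌋<n (suc n′)) (s≤s z≤n)
    log-n : ⌊log₂ n ⌋ ≡ suc lₕ
    log-n = begin-equality
      ⌊log₂ n ⌋           ≡⟨ m+[n∸m]≡n (⌊log₂⌋-mono-≤ {2} {n} (s≤s (s≤s z≤n))) ⟨
      suc (⌊log₂ n ⌋ ∸ 1) ≡⟨ cong suc (⌊log₂⌊n/2⌋⌋≡⌊log₂n⌋∸1 n) ⟨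
      suc lₕ              ∎
    lower : 2 ^ suc lₕ ≤ n
    lower = begin
      2 * 2 ^ lₕ    ≤⟨ *-monoʳ-≤ 2 (proj₁ ihₕ) ⟩
      2 * h         ≡⟨ cong (h +_) (+-identityʳ h) ⟩
      h + h         ≤⟨ +-monoʳ-≤ h (⌊n/2⌋≤⌈n/2⌉ n) ⟩
      h + ⌈ n /2⌉   ≡⟨ ⌊n/2⌋+⌈n/2⌉≡n n ⟩
      n             ∎
    upper : n < 2 ^ suc (suc lₕ)
    upper = begin
      suc n            ≡⟨ cong suc (⌊n/2⌋+⌈n/2⌉≡n n) ⟨
      suc (h + ⌈ n /2⌉) ≤⟨ s≤s (+-monoʳ-≤ h (⌊n/2⌋-mono (n≤1+n (suc n)))) ⟩
      suc (h + suc h)  ≡⟨ lemma h ⟩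
      2 * suc h        ≤⟨ *-monoʳ-≤ 2 (proj₂ ihₕ) ⟩
      2 * 2 ^ suc lₕ   ∎
      where
      lemma : ∀ h → suc (h + suc h) ≡ 2 * suc h
      lemma = solve-∀

-- The combinatorial number system

code : (ℕ → Bool) → ℕ → ℕ
code ψ zero    = 0
code ψ (suc t) = code ψ t + (if ψ t then t choose suc (count ψ t) else 0)

decode : (t k c : ℕ) → ℕ → Bool
decode zero    k c y = false
decode (suc t) k c y =
  if c <ᵇ t choose k then (if y ≡ᵇ t then false else decode t k c y)
                else (if y ≡ᵇ t then true  else decode t (k ∸ 1) (c ∸ t choose k) y)

choose-mono : ∀ t k → t choose k ≤ suc t choose k
choose-mono t zero    = ≤-refl
choose-mono t (suc k) = ≤-trans (m≤n+m _ _) (≤-reflexive (nCk+nC[k+1]≡[n+1]C[k+1] t k))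

-- Pascal's rule: among strings of length t + 1 with k ones, those with a 0 in position t have the
-- codes below `t choose k`, and those with a 1 are shifted past them. `decode` compares with
-- `t choose k` for this reason.
code< : ∀ ψ t → code ψ t < t choose count ψ t
code< ψ zero    = s≤s z≤n
code< ψ (suc t) with ψ t
... | false rewrite +-identityʳ (count ψ t) | +-identityʳ (code ψ t) = ≤-trans (code< ψ t) (choose-mono t (count ψ t))
... | true  rewrite +-comm (count ψ t) 1 = ≤-trans (+-monoˡ-< _ (code< ψ t))
      (≤-reflexive (nCk+nC[k+1]≡[n+1]C[k+1] t (count ψ t)))

≡ᵇ-false : ∀ {m n} → m < n → (m ≡ᵇ n) ≡ false
≡ᵇ-false {m} {n} m<n with m ≡ᵇ n in eq
... | false = refl
... | true  = contradiction (≡ᵇ⇒≡ m n (Equivalence.from T-≡ eq)) (<⇒≢ m<n)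

decode-code : ∀ ψ t {y} → y < t → decode t (count ψ t) (code ψ t) y ≡ ψ y
decode-code ψ (suc t) {y} (s≤s y≤t) with ψ t in eq
decode-code ψ (suc t) {y} (s≤s y≤t) | false
  rewrite +-identityʳ (count ψ t) | +-identityʳ (code ψ t) | <ᵇ-true (code< ψ t) with m≤n⇒m<n∨m≡n y≤t
... | inj₁ y<t rewrite ≡ᵇ-false y<t = decode-code ψ t y<t
... | inj₂ refl rewrite ≡ᵇ-refl y = sym eq
decode-code ψ (suc t) {y} (s≤s y≤t) | true
  rewrite +-comm (count ψ t) 1 | <ᵇ-false (m≤n+m (t choose suc (count ψ t)) (code ψ t)) with m≤n⇒m<n∨m≡n y≤t
... | inj₁ y<t rewrite ≡ᵇ-false y<t | m+n∸n≡m (code ψ t) (t choose suc (count ψ t)) = decode-code ψ t y<t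
... | inj₂ refl rewrite ≡ᵇ-refl y = sym eq

-- Rounding costs at most one bit per block: it is the factor 2 in `block-cost`.
codeLength : (b k : ℕ) → ℕ
codeLength b k = suc ⌊log₂ (b choose k) ⌋

-- A single term of the binomial expansion. After division by the right side it says that the
-- strings with k ones and z zeros have total probability at most 1 when ones have probability
-- x/(x+y). Pascal's rule gives the induction.
binomial-term≤ : ∀ x y k z → ((k + z) choose k) * (x ^ k * y ^ z) ≤ (x + y) ^ (k + z)
binomial-term≤ x y zero z = begin
  1 * (1 * y ^ z)  ≡⟨ trans (*-identityˡ _) (*-identityˡ _) ⟩
  y ^ z            ≤⟨ ^-monoˡ-≤ z (m≤n+m y x) ⟩
  (x + y) ^ z      ∎
  where open ≤-Reasoning
binomial-term≤ x y k@(suc j) zero rewrite +-identityʳ j = begin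
  (k choose k) * (x ^ k * 1) ≡⟨ cong (_* (x ^ k * 1)) (nCn≡1 k) ⟩
  1 * (x ^ k * 1)       ≡⟨ trans (*-identityˡ _) (*-identityʳ _) ⟩
  x ^ k                 ≤⟨ ^-monoˡ-≤ k (m≤m+n x y) ⟩
  (x + y) ^ k           ∎
  where open ≤-Reasoning
binomial-term≤ x y (suc k) (suc z) = begin
  (suc n choose suc k) * (x ^ suc k * y ^ suc z)
    ≡⟨ cong (_* (x ^ suc k * y ^ suc z)) (nCk+nC[k+1]≡[n+1]C[k+1] n k) ⟨
  (n choose k + n choose suc k) * (x * x ^ k * (y * y ^ z))
    ≡⟨ lemma (n choose k) (n choose suc k) x y (x ^ k) (y ^ z) ⟩
  x * ((n choose k) * (x ^ k * y ^ suc z)) + y * ((n choose suc k) * (x ^ suc k * y ^ z))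
    ≤⟨ +-mono-≤ (*-monoʳ-≤ x (binomial-term≤ x y k (suc z))) (*-monoʳ-≤ y right) ⟩
  x * (x + y) ^ n + y * (x + y) ^ n
    ≡⟨ *-distribʳ-+ ((x + y) ^ n) x y ⟨
  (x + y) ^ suc n ∎
  where
  open ≤-Reasoning
  n = k + suc z
  right : (n choose suc k) * (x ^ suc k * y ^ z) ≤ (x + y) ^ n
  right = subst (λ m → (m choose suc k) * (x ^ suc k * y ^ z) ≤ (x + y) ^ m) (sym (+-suc k z))
            (binomial-term≤ x y (suc k) z)
  lemma : ∀ a b x y p q → (a + b) * (x * p * (y * q)) ≡ x * (a * (p * (y * q))) + y * (b * (x * p * q))
  lemma = solve-∀

module _ (d : ℕ) .{{_ : NonZero d}} where

  [q*d+r]/d≡q : ∀ q {r} → r < d → (q * d + r) / d ≡ q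
  [q*d+r]/d≡q q {r} r<d = trans (+-distrib-/-∣ˡ r (n∣m*n q))
    (trans (cong₂ _+_ (m*n/n≡m q d) (m<n⇒m/n≡0 r<d)) (+-identityʳ q))

  [q*d+r]%d≡r : ∀ q {r} → r < d → (q * d + r) % d ≡ r
  [q*d+r]%d≡r q {r} r<d =
    trans (cong (_% d) (+-comm (q * d) r)) (trans ([m+kn]%n≡m%n r q d) (m<n⇒m%n≡m r<d))

  m/d*d+m%d≡m : ∀ m → m / d * d + m % d ≡ m
  m/d*d+m%d≡m m = trans (+-comm (m / d * d) (m % d)) (sym (m≡m%n+[m/n]*n m d))

  m<[1+m/d]*d : ∀ m → m < suc (m / d) * d
  m<[1+m/d]*d m = ≤-<-trans (≤-reflexive (m≡m%n+[m/n]*n m d)) (+-monoˡ-< (m / d * d) (m%n<n m d))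

  -- As ⌊i/d⌋ d ≤ r - 1 < i, the numbers r - 1 and i have the same quotient by d.
  same-group : ∀ {i r} → i / d * d < r → r ≤ i → (r ∸ 1) / d * d + i % d ≡ i
  same-group {i} {suc r} (s≤s j≤r) r<i =
    trans (cong (λ q → q * d + i % d) (≤-antisym (/-monoˡ-≤ d (<⇒≤ r<i))
             (≤-trans (≤-reflexive (sym (m*n/n≡m (i / d) d))) (/-monoˡ-≤ d j≤r))))
      (m/d*d+m%d≡m i)

holds-bit : ∀ μ f k → Holds μ (applyUpTo f k) → ∀ {j} → j < k → μ j ≡ f j
holds-bit μ f k holds {j} j<k = begin
  μ j         ≡⟨ cong μ toℕ-i ⟨
  μ (toℕ i)   ≡⟨ holds i ⟩
  lookup (applyUpTo f k) i ≡⟨ lookup-applyUpTo f k i ⟩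
  f (toℕ i)   ≡⟨ cong f toℕ-i ⟩
  f j         ∎
  where
  open ≡-Reasoning
  j<length = subst (j <_) (sym (length-applyUpTo f k)) j<k
  i = fromℕ< j<length
  toℕ-i : toℕ i ≡ j
  toℕ-i = toℕ-fromℕ< j<length

-- Blocks, their classes and the stream of codes

module Blocks (b : ℕ) (χ : ℕ → Bool) where

  block : ℕ → (ℕ → Bool)
  block B t = χ (B * b + t)

  class len ones pos : ℕ → ℕ
  class B = count (block B) b
  len B = codeLength b (class B)
  ones = psum class
  pos = psum len

  ones-count : ∀ B → ones B ≡ count χ (B * b)
  ones-count zero    = refl
  ones-count (suc B) = trans (cong (_+ class B) (ones-count B))
    (trans (sym (psum-+ (indicator ∘ χ) (B * b) b)) (cong (count χ) (+-comm (B * b) b)))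

  count-block : ∀ B t → count χ (B * b + t) ≡ ones B + count (block B) t
  count-block B t = trans (psum-+ (indicator ∘ χ) (B * b) t) (cong (_+ count (block B) t) (sym (ones-count B)))

  choose≤2^b : ∀ {k} → k ≤ b → b choose k ≤ 2 ^ b
  choose≤2^b {k} k≤b = begin
    b choose k  ≡⟨ *-identityʳ (b choose k) ⟨
    (b choose k) * 1 ≡⟨ cong₂ (λ n p → (n choose k) * p) (m+[n∸m]≡n k≤b) (cong₂ _*_ (^-zeroˡ k) (^-zeroˡ (b ∸ k))) ⟨
    ((k + (b ∸ k)) choose k) * (1 ^ k * 1 ^ (b ∸ k)) ≤⟨ binomial-term≤ 1 1 k (b ∸ k) ⟩
    2 ^ (k + (b ∸ k)) ≡⟨ cong (2 ^_) (m+[n∸m]≡n k≤b) ⟩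
    2 ^ b ∎
    where open ≤-Reasoning

  class≤ : ∀ B → class B ≤ b
  class≤ B = count≤ (block B) b

  log-choose : ∀ B → 2 ^ ⌊log₂ (b choose class B) ⌋ ≤ b choose class B × b choose class B < 2 ^ len B
  log-choose B = log₂-bounds (b choose class B) (≤-<-trans z≤n (code< (block B) b))

  len≤ : ∀ B → len B ≤ suc b
  len≤ B = s≤s (≮⇒≥ λ b< → <⇒≱ (^-monoʳ-< 2 (s≤s (s≤s z≤n)) b<)
                              (≤-trans (proj₁ (log-choose B)) (choose≤2^b (class≤ B))))

  code<2^len : ∀ B → code (block B) b < 2 ^ len B
  code<2^len B = <-trans (code< (block B) b) (proj₂ (log-choose B))

  stream : ℕ → (ℕ → Bool)
  stream = concat len (λ B → bit (code (block B) b))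

-- The layout of the encoding

module Structure
  (n w β b g G₁ G₂ M : ℕ) (χ : ℕ → Bool)
  .{{_ : NonZero b}} .{{_ : NonZero g}} .{{_ : NonZero G₁}} .{{_ : NonZero G₂}}
  where

  open Blocks b χ public

  instance
    2^b≢0 : NonZero (2 ^ b)
    2^b≢0 = m^n≢0 2 b

  lastBlock lastSuper : ℕ
  lastBlock = n / b
  lastSuper = lastBlock / g

  -- Meaningful only for i < count χ n: the array entries at other i are never used.
  pick blockOf superOf : ℕ → ℕ
  pick i = position χ (suc lastBlock * b) i
  blockOf i = pick i / b
  superOf i = blockOf i / g

  -- A group of G₁ (G₂) consecutive ones that starts in superblock (block) B
  -- and leaves it is the group of the last one before the end of B; hence
  -- one row of explicit answers per superblock (block) suffices.
  inGroup : (d : ℕ) .{{_ : NonZero d}} → (end t : ℕ) → ℕ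
  inGroup d end t = (end ∸ 1) / d * d + t

  -- Segment 0 is the header; 1, 2 and 3, 4 are the two-level directories of ones
  -- and pos; 5 and 6 tabulate rank and select inside a block, by class, code and
  -- argument; 7, 8 and 9, 10 locate the superblock and the block of a one (group
  -- starts, then explicit rows); 11 is the stream of block codes.
  size width base : ℕ → ℕ
  size 0 = 19
  -- The directories also have an entry one past the last block or superblock: classes and code
  -- lengths are differences of consecutive entries, and `superOfᴱ` compares with the end of a
  -- superblock.
  size 1 = lastSuper + 2
  size 2 = lastBlock + 2
  size 3 = lastSuper + 2
  size 4 = lastBlock + 2
  -- Each class is given 2 ^ b codes, although only `b choose k` of them occur, so that a row is
  -- addressed by one multiplication and one addition.
  size 5 = suc b * 2 ^ b * b
  size 6 = suc b * 2 ^ b * b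
  size 7 = n / G₁ + 1
  size 8 = (lastSuper + 1) * G₁
  size 9 = n / G₂ + 1
  size 10 = (lastBlock + 1) * G₂
  size _ = pos (suc lastBlock)

  -- The short width β serves the entries relative to a superblock: differences of `ones` or `pos`,
  -- and block numbers modulo g.
  width 2 = β
  width 4 = β
  width 9 = β
  width 10 = β
  width 11 = 1
  width _ = w

  segLength : ℕ → ℕ
  segLength k = size k * width k

  base = psum segLength

  total : ℕ
  total = base 12

  headerWord : ℕ → ℕ
  headerWord 0 = w
  headerWord 1 = β
  headerWord 2 = b
  headerWord 3 = g
  headerWord 4 = G₁
  headerWord 5 = G₂
  headerWord 6 = M
  headerWord 7 = 2 ^ b
  headerWord (suc (suc (suc (suc (suc (suc (suc (suc k)))))))) = base (suc k)

  decodeAt : ℕ → (ℕ → Bool)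
  decodeAt r = decode b (r / 2 ^ b) (r % 2 ^ b)

  content : ℕ → ℕ → ℕ
  content 0 i = headerWord i
  content 1 s = ones (s * g)
  content 2 B = ones B ∸ ones (B / g * g)
  content 3 s = pos (s * g)
  content 4 B = pos B ∸ pos (B / g * g)
  content 5 i = count (decodeAt (i / b)) (suc (i % b))
  content 6 i = position (decodeAt (i / b)) b (i % b)
  content 7 q = superOf (q * G₁)
  content 8 i = superOf (inGroup G₁ (ones (suc (i / G₁) * g)) (i % G₁))
  content 9 q = blockOf (q * G₂) % g
  content 10 i = blockOf (inGroup G₂ (ones (suc (i / G₂))) (i % G₂)) % g
  content _ j = indicator (stream (suc lastBlock) j)

  segment : ℕ → (ℕ → Bool)
  segment k = concat (λ _ → width k) (λ i → bit (content k i)) (size k)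

  encoding : List Bool
  encoding = applyUpTo (concat segLength segment 12) total

-- The query expressions

-- Header word 7 + k holds base k, for 1 ≤ k ≤ 11; the word size, in header
-- word 0, is found by reading a block of length 2 ^ w - 1, which is cut down to w.

word : Expr
word = read (# 0) (calc SUB (# 0) (# 1))

header : ℕ → Expr
header j = read (calc MUL (# j) word) word

entry : ℕ → (width index : Expr) → Expr
entry k wd i = read (calc ADD (header (7 + k)) (calc MUL i wd)) wd

βᴱ bᴱ gᴱ G₁ᴱ G₂ᴱ Mᴱ 2^bᴱ : Expr
βᴱ = header 1
bᴱ = header 2
gᴱ = header 3
G₁ᴱ = header 4
G₂ᴱ = header 5
Mᴱ = header 6
2^bᴱ = header 7

directory : ℕ → Expr → Expr
directory k B = calc ADD (entry k word (calc DIV B gᴱ)) (entry (suc k) βᴱ B)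

onesᴱ posᴱ classᴱ codeᴱ next : Expr → Expr
next B = calc ADD B (# 1)
onesᴱ = directory 1
posᴱ = directory 3
classᴱ B = calc SUB (onesᴱ (next B)) (onesᴱ B)
codeᴱ B = read (calc ADD (header 18) (posᴱ B)) (calc SUB (posᴱ (next B)) (posᴱ B))

lookupᴱ : ℕ → (B y : Expr) → Expr
lookupᴱ k B y =
  entry k word (calc ADD (calc MUL (calc ADD (calc MUL (classᴱ B) 2^bᴱ) (codeᴱ B)) bᴱ) y)

rankᴱ : Expr
rankᴱ = calc ADD (onesᴱ B) (lookupᴱ 5 B (calc MOD query bᴱ))
  where B = calc DIV query bᴱ

-- For i, r < M, the quotient (i + M - r) / M is 1 if r ≤ i and 0 otherwise.
reachedᴱ : (i r : Expr) → Expr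
reachedᴱ i r = calc DIV (calc SUB (calc ADD i Mᴱ) r) Mᴱ

chooseᴱ : (flag e₁ e₀ : Expr) → Expr
chooseᴱ f e₁ e₀ = calc ADD (calc MUL f e₁) (calc MUL (calc SUB (# 1) f) e₀)

superOfᴱ : Expr → Expr
superOfᴱ i = chooseᴱ (reachedᴱ i (entry 1 word (next s₀)))
               (entry 8 word (calc ADD (calc MUL s₀ G₁ᴱ) (calc MOD i G₁ᴱ))) s₀
  where s₀ = entry 7 word (calc DIV i G₁ᴱ)

-- Block numbers are stored only modulo g, so the superblock is needed twice: that of the first one
-- in the group gives B₀, and that of i itself completes the explicit answer when the group has left
-- B₀.
blockOfᴱ : Expr → Expr
blockOfᴱ i = chooseᴱ (reachedᴱ i (onesᴱ (next B₀)))
               (calc ADD (calc MUL (superOfᴱ i) gᴱ)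
                         (entry 10 βᴱ (calc ADD (calc MUL B₀ G₂ᴱ) (calc MOD i G₂ᴱ)))) B₀
  where
  q = calc DIV i G₂ᴱ
  B₀ = calc ADD (calc MUL (superOfᴱ (calc MUL q G₂ᴱ)) gᴱ) (entry 9 βᴱ q)

selectᴱ : Expr
selectᴱ = calc ADD (calc MUL B bᴱ) (lookupᴱ 6 B (calc SUB i (onesᴱ B)))
  where
  -- Queries count the ones from 1, `position` counts them from 0.
  i = calc SUB query (# 1)
  B = blockOfᴱ i

-- Correctness of the query expressions

bit-indicator : ∀ c → bit (indicator c) 0 ≡ c
bit-indicator false = refl
bit-indicator true  = refl

row-major< : ∀ {r R c d} → r < R → c < d → r * d + c < R * d
row-major< {r} {R} {c} {d} r<R c<d = begin-strict
  r * d + c <⟨ +-monoʳ-< (r * d) c<d ⟩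
  r * d + d ≡⟨ +-comm (r * d) d ⟩
  suc r * d ≤⟨ *-monoˡ-≤ d r<R ⟩
  R * d ∎
  where open ≤-Reasoning

1+m/d≤ : ∀ d .{{_ : NonZero d}} m → suc m / d ≤ suc (m / d)
1+m/d≤ d m = ≤-trans (/-monoˡ-≤ d (m<[1+m/d]*d d m)) (≤-reflexive (m*n/n≡m (suc (m / d)) d))

1<2^k⇒0<k : ∀ k → 1 < 2 ^ k → 0 < k
1<2^k⇒0<k zero    1<1 = ⊥-elim (<-irrefl refl 1<1)
1<2^k⇒0<k (suc k) _   = s≤s z≤n

module _
  (n w β b g G₁ G₂ M : ℕ) (χ : ℕ → Bool)
  .{{_ : NonZero b}} .{{_ : NonZero g}} .{{_ : NonZero G₁}} .{{_ : NonZero G₂}}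
  where

  open Structure n w β b g G₁ G₂ M χ

  module Correctness
    (0<w : 0 < w) (β≤w : β ≤ w) (b<w : b < w)
    -- The room for M + M keeps the sum `i + M` in `reachedᴱ` from overflowing.
    (n<M : n < M) (2M≤2^w : M + M ≤ 2 ^ w)
    (parameter< : ∀ j → j < 8 → headerWord j < 2 ^ w)
    (total< : total < 2 ^ w)
    (relative< : g * suc b < 2 ^ β)
    (count≤n : ∀ y → count χ y ≤ n)
    (μ : Memory) (holds : Holds μ encoding) (x : ℕ)
    where

    open Evaluation w μ x

    M<2^w : M < 2 ^ w
    M<2^w = <-≤-trans (m<m+n M (≤-<-trans z≤n n<M)) 2M≤2^w

    ≤n⇒fits : ∀ {v} → v ≤ n → v < 2 ^ w
    ≤n⇒fits v≤n = <-trans (≤-<-trans v≤n n<M) M<2^w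

    1<2^w : 1 < 2 ^ w
    1<2^w = ^-monoʳ-≤ 2 0<w

    memory-bit : ∀ {k i t} → k < 12 → i < size k → t < width k →
                 μ (base k + (i * width k + t)) ≡ bit (content k i) t
    memory-bit {k} {i} {t} k<12 i< t< = begin
      μ (base k + offset)
        ≡⟨ holds-bit μ (concat segLength segment 12) total holds
             (<-≤-trans (+-monoʳ-< (base k) offset<) (psum-mono segLength k<12)) ⟩
      concat segLength segment 12 (base k + offset) ≡⟨ concat-bit segLength segment k<12 offset< ⟩
      segment k offset ≡⟨ cong (λ o → segment k (o + t)) (psum-const (width k) i) ⟨
      segment k (psum (λ _ → width k) i + t) ≡⟨ concat-bit (λ _ → width k) (λ i → bit (content k i)) i< t< ⟩
      bit (content k i) t ∎
      where
      open ≡-Reasoning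
      offset = i * width k + t
      offset< : offset < segLength k
      offset< = row-major< i< t<

    base≤total : ∀ {k} → k ≤ 12 → base k ≤ total
    base≤total = psum-mono segLength

    address≤ : ∀ {k i} → k < 12 → i < size k → base k + i * width k ≤ total
    address≤ {k} {i} k<12 i< =
      ≤-trans (+-monoʳ-≤ (base k) (*-monoˡ-≤ (width k) (<⇒≤ i<))) (psum-mono segLength k<12)

    size≤total : ∀ {k} → k < 12 → 0 < width k → size k ≤ total
    size≤total {k} k<12 0<wd = begin
      size k           ≤⟨ m≤m*n (size k) (width k) {{>-nonZero 0<wd}} ⟩
      segLength k      ≤⟨ m≤n+m (segLength k) (base k) ⟩
      base (suc k)     ≤⟨ base≤total k<12 ⟩
      total            ∎
      where open ≤-Reasoning

    word⇒ : word ⇒ w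
    word⇒ = eval≡ (begin
      readBlock μ (truncate w 0) (truncate w (truncate w 0 + 2 ^ w ∸ truncate w 1) ⊓ w)
        ≡⟨ cong₂ (λ a o → readBlock μ a (truncate w (a + 2 ^ w ∸ o) ⊓ w))
             (truncate-small w (m^n>0 2 w)) (truncate-small w 1<2^w) ⟩
      readBlock μ 0 (truncate w (2 ^ w ∸ 1) ⊓ w)
        ≡⟨ cong (λ k → readBlock μ 0 (k ⊓ w)) (truncate-small w (∸-monoʳ-< {2 ^ w} {1} {0} (s≤s z≤n) (m^n>0 2 w))) ⟩
      readBlock μ 0 ((2 ^ w ∸ 1) ⊓ w)
        ≡⟨ cong (readBlock μ 0) (m≥n⇒m⊓n≡n (m+n≤o⇒m≤o∸n w (≤-trans (≤-reflexive (+-comm w 1)) (n<2^n w)))) ⟩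
      readBlock μ 0 w
        ≡⟨ readBlock-value μ 0 w (memory-bit {0} {0} (s≤s z≤n) (s≤s z≤n)) (n<2^n w) ⟩
      w ∎)
      where open ≡-Reasoning

    header⇒ : ∀ {j} → j < 19 → headerWord j < 2 ^ w → header j ⇒ headerWord j
    header⇒ {j} j<19 fits =
      read⇒ (mul⇒ (#⇒ (≤-<-trans (m≤m*n j w {{>-nonZero 0<w}}) j*w<)) word⇒ j*w<)
        word⇒ ≤-refl (λ t< → memory-bit {0} (s≤s z≤n) j<19 t<) fits
      where
      j*w< : j * w < 2 ^ w
      j*w< = ≤-<-trans (address≤ {0} (s≤s z≤n) j<19) total<

    parameter⇒ : ∀ j → {_ : T (j <ᵇ 8)} → header j ⇒ headerWord j
    parameter⇒ j {j<8} = header⇒ (<-≤-trans j<8′ (m≤m+n 8 11)) (parameter< j j<8′)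
      where j<8′ = <ᵇ⇒< j 8 j<8

    base⇒ : ∀ k → suc k < 12 → header (8 + k) ⇒ base (suc k)
    base⇒ k k<12 = header⇒ (+-monoʳ-< 7 k<12) (≤-<-trans (base≤total (<⇒≤ k<12)) total<)

    -- The hypotheses on k are decided by evaluation when k is a numeral.
    entry⇒ : ∀ k {_ : T (suc k <ᵇ 12)} {wd e i} → 0 < width (suc k) → width (suc k) ≤ w →
             wd ⇒ width (suc k) → e ⇒ i → i < size (suc k) → content (suc k) i < 2 ^ width (suc k) →
             entry (suc k) wd e ⇒ content (suc k) i
    entry⇒ k {k<} {i = i} 0<wd wd≤w wd⇒ e⇒ i< fits =
      read⇒ (add⇒ (base⇒ k k<12) (mul⇒ e⇒ wd⇒ (≤-<-trans (m≤n+m _ (base (suc k))) addr<)) addr<)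
        wd⇒ wd≤w
        (λ {t} t< → trans (cong μ (+-assoc (base (suc k)) (i * width (suc k)) t)) (memory-bit k<12 i< t<)) fits
      where
      k<12 = <ᵇ⇒< (suc k) 12 k<
      addr< : base (suc k) + i * width (suc k) < 2 ^ w
      addr< = ≤-<-trans (address≤ k<12 i<) total<

    0<β : 0 < β
    0<β = 1<2^k⇒0<k β (≤-<-trans (*-mono-≤ (>-nonZero⁻¹ g) (s≤s z≤n)) relative<)

    lastBlock≤ : lastBlock ≤ n
    lastBlock≤ = m/n≤m n b

    psum-split : ∀ f B → psum f (B / g * g) + (psum f B ∸ psum f (B / g * g)) ≡ psum f B
    psum-split f B = m+[n∸m]≡n (psum-mono f (m/n*n≤m B g))

    relative-bound : ∀ f → (∀ B → f B ≤ suc b) → ∀ B → psum f B ∸ psum f (B / g * g) < 2 ^ β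
    relative-bound f f≤ B = ≤-<-trans (m≤n+o⇒m∸n≤o (psum f B) (psum f s) bound) relative<
      where
      open ≤-Reasoning
      s = B / g * g
      bound : psum f B ≤ psum f s + g * suc b
      bound = begin
        psum f B                          ≡⟨ cong (psum f) (m/d*d+m%d≡m g B) ⟨
        psum f (s + B % g)                ≡⟨ psum-+ f s (B % g) ⟩
        psum f s + psum (f ∘ (s +_)) (B % g) ≤⟨ +-monoʳ-≤ (psum f s) (psum-bound (B % g) (f≤ ∘ (s +_))) ⟩
        psum f s + B % g * suc b          ≤⟨ +-monoʳ-≤ (psum f s) (*-monoˡ-≤ (suc b) (<⇒≤ (m%n<n B g))) ⟩
        psum f s + g * suc b              ∎

    super< : ∀ {B} → B ≤ suc lastBlock → B / g < lastSuper + 2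
    super< B≤ = ≤-<-trans (≤-trans (/-monoˡ-≤ g B≤) (1+m/d≤ g lastBlock)) (≤-reflexive (sym (+-comm lastSuper 2)))

    block<+2 : ∀ {B} → B ≤ suc lastBlock → B < lastBlock + 2
    block<+2 B≤ = ≤-trans (s≤s B≤) (≤-reflexive (sym (+-comm lastBlock 2)))

    ones≤n : ∀ B → ones B ≤ n
    ones≤n B = ≤-trans (≤-reflexive (ones-count B)) (count≤n (B * b))

    pos-fits : ∀ {B} → B ≤ suc lastBlock → pos B < 2 ^ w
    pos-fits B≤ = ≤-<-trans (≤-trans (psum-mono len B≤) (size≤total {11} ≤-refl (s≤s z≤n))) total<

    ones⇒ : ∀ {e B} → e ⇒ B → B ≤ suc lastBlock → onesᴱ e ⇒ ones B
    ones⇒ {e} {B} e⇒ B≤ =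
       add⇒ (entry⇒ 0 0<w ≤-refl word⇒ (div⇒ e⇒ (parameter⇒ 3)) (super< B≤) (≤n⇒fits (ones≤n (B / g * g))))
            (entry⇒ 1 0<β β≤w (parameter⇒ 1) e⇒ (block<+2 B≤)
              (relative-bound class (λ B → m≤n⇒m≤1+n (class≤ B)) B))
            (≤n⇒fits (≤-trans (≤-reflexive (psum-split class B)) (ones≤n B)))
      as psum-split class B

    pos⇒ : ∀ {e B} → e ⇒ B → B ≤ suc lastBlock → posᴱ e ⇒ pos B
    pos⇒ {e} {B} e⇒ B≤ =
       add⇒ (entry⇒ 2 0<w ≤-refl word⇒ (div⇒ e⇒ (parameter⇒ 3)) (super< B≤)
              (pos-fits (≤-trans (m/n*n≤m B g) B≤)))
            (entry⇒ 3 0<β β≤w (parameter⇒ 1) e⇒ (block<+2 B≤) (relative-bound len len≤ B))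
            (≤-<-trans (≤-reflexive (psum-split len B)) (pos-fits B≤))
      as psum-split len B

    next⇒ : ∀ {e B} → e ⇒ B → B ≤ n → next e ⇒ suc B
    next⇒ {B = B} e⇒ B≤n =
       add⇒ e⇒ (#⇒ 1<2^w) (≤-<-trans (≤-reflexive (+-comm B 1)) (≤-<-trans (≤-<-trans B≤n n<M) M<2^w))
      as +-comm B 1

    class⇒ : ∀ {e B} → e ⇒ B → B ≤ lastBlock → classᴱ e ⇒ class B
    class⇒ {e} {B} e⇒ B≤ =
       sub⇒ (ones⇒ (next⇒ e⇒ (≤-trans B≤ lastBlock≤)) (s≤s B≤)) (ones⇒ e⇒ (m≤n⇒m≤1+n B≤))
        (m≤m+n (ones B) (class B)) (≤n⇒fits (ones≤n (suc B)))
      as m+n∸m≡n (ones B) (class B)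

    code⇒ : ∀ {e B} → e ⇒ B → B ≤ lastBlock → codeᴱ e ⇒ code (block B) b
    code⇒ {e} {B} e⇒ B≤ =
      read⇒ (add⇒ (base⇒ 10 ≤-refl) (pos⇒ e⇒ (m≤n⇒m≤1+n B≤)) addr<)
        (sub⇒ (pos⇒ (next⇒ e⇒ (≤-trans B≤ lastBlock≤)) (s≤s B≤)) (pos⇒ e⇒ (m≤n⇒m≤1+n B≤))
          (m≤m+n (pos B) (len B)) (pos-fits (s≤s B≤)) as m+n∸m≡n (pos B) (len B))
        (≤-trans (len≤ B) b<w) bits (code<2^len B)
      where
      pos≤ : pos B ≤ size 11
      pos≤ = psum-mono len (m≤n⇒m≤1+n B≤)
      addr< : base 11 + pos B < 2 ^ w
      addr< = ≤-<-trans (+-monoʳ-≤ (base 11) (≤-trans pos≤ (≤-reflexive (sym (*-identityʳ (size 11)))))) total<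
      bits : ∀ {t} → t < len B → μ (base 11 + pos B + t) ≡ bit (code (block B) b) t
      bits {t} t< = begin
        μ (base 11 + pos B + t) ≡⟨ cong μ (trans (+-assoc (base 11) (pos B) t)
              (cong (base 11 +_) (sym (trans (+-identityʳ (j * 1)) (*-identityʳ j))))) ⟩
        μ (base 11 + (j * 1 + 0)) ≡⟨ memory-bit {11} {j} ≤-refl
              (<-≤-trans (+-monoʳ-< (pos B) t<) (psum-mono len (s≤s B≤))) (s≤s z≤n) ⟩
        bit (indicator (stream (suc lastBlock) j)) 0 ≡⟨ bit-indicator (stream (suc lastBlock) j) ⟩
        stream (suc lastBlock) j ≡⟨ concat-bit len (λ B → bit (code (block B) b)) (s≤s B≤) t< ⟩
        bit (code (block B) b) t ∎
        where
        open ≡-Reasoning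
        j = pos B + t

    pattern-index : ℕ → ℕ
    pattern-index B = class B * 2 ^ b + code (block B) b

    code<2^b : ∀ B → code (block B) b < 2 ^ b
    code<2^b B = <-≤-trans (code< (block B) b) (choose≤2^b (class≤ B))

    pattern-index< : ∀ B → pattern-index B < suc b * 2 ^ b
    pattern-index< B = row-major< (s≤s (class≤ B)) (code<2^b B)

    decodeAt-block : ∀ B {t} → t < b → decodeAt (pattern-index B) t ≡ block B t
    decodeAt-block B t<b
      rewrite [q*d+r]/d≡q (2 ^ b) (class B) (code<2^b B) | [q*d+r]%d≡r (2 ^ b) (class B) (code<2^b B) =
      decode-code (block B) b t<b

    count-decodeAt : ∀ B {t} → t ≤ b → count (decodeAt (pattern-index B)) t ≡ count (block B) t
    count-decodeAt B {t} t≤b = psum-cong t (λ i<t → cong indicator (decodeAt-block B (<-≤-trans i<t t≤b)))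

    -- The two equations hold by `refl` for segments 5 and 6, so that one lemma serves both tables.
    lookup⇒ : ∀ k {e d B y} → e ⇒ B → B ≤ lastBlock → d ⇒ y → y < b → {_ : T (suc k <ᵇ 12)} →
              size (suc k) ≡ suc b * 2 ^ b * b → width (suc k) ≡ w →
              content (suc k) (pattern-index B * b + y) < 2 ^ width (suc k) →
              lookupᴱ (suc k) e d ⇒ content (suc k) (pattern-index B * b + y)
    lookup⇒ k {e} {d} {B} {y} e⇒ B≤ d⇒ y<b {k<} size≡ width≡ fits =
      entry⇒ k {k<} (≤-trans 0<w (≤-reflexive (sym width≡))) (≤-reflexive width≡) (word⇒ as sym width≡)
        (add⇒ (mul⇒ (add⇒ (mul⇒ (class⇒ e⇒ B≤) (parameter⇒ 7) (≤-<-trans step₃ index<)) (code⇒ e⇒ B≤)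
            (≤-<-trans step₂ index<))
                    (parameter⇒ 2) (≤-<-trans step₁ index<)) d⇒ index<)
        (<-≤-trans in-range (≤-reflexive (sym size≡))) fits
      where
      in-range : pattern-index B * b + y < suc b * 2 ^ b * b
      in-range = row-major< (pattern-index< B) y<b
      index< : pattern-index B * b + y < 2 ^ w
      index< = <-trans in-range (≤-<-trans (size≤total {5} (s≤s (s≤s (s≤s (s≤s (s≤s (s≤s z≤n)))))) 0<w) total<)
      step₁ : pattern-index B * b ≤ pattern-index B * b + y
      step₁ = m≤m+n _ y
      step₂ : pattern-index B ≤ pattern-index B * b + y
      step₂ = ≤-trans (m≤m*n (pattern-index B) b) step₁
      step₃ : class B * 2 ^ b ≤ pattern-index B * b + y
      step₃ = ≤-trans (m≤m+n _ (code (block B) b)) step₂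

    /b≤lastBlock : ∀ {y} → y < n → y / b ≤ lastBlock
    /b≤lastBlock y<n = /-monoˡ-≤ b (<⇒≤ y<n)

    rank⇒ : x < n → rankᴱ ⇒ count χ (suc x)
    rank⇒ x<n =
       add⇒ (ones⇒ B⇒ (m≤n⇒m≤1+n B≤)) (lookup⇒ 4 B⇒ B≤ (mod⇒ x⇒ (parameter⇒ 2)) i<b refl refl
               (≤n⇒fits (≤-trans (≤-reflexive value) (≤-trans (m≤n+m _ (ones B)) total≤n))) as value)
            (≤n⇒fits total≤n)
      as whole
      where
      B = x / b
      i = x % b
      i<b = m%n<n x b
      x⇒ = query⇒ (≤n⇒fits (<⇒≤ x<n))
      B⇒ = div⇒ x⇒ (parameter⇒ 2)
      B≤ = /b≤lastBlock x<n
      value : content 5 (pattern-index B * b + i) ≡ count (block B) (suc i)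
      value = trans
        (cong₂ (λ p t → count (decodeAt p) (suc t)) ([q*d+r]/d≡q b (pattern-index B) i<b)
            ([q*d+r]%d≡r b (pattern-index B) i<b))
        (count-decodeAt B i<b)
      whole : ones B + count (block B) (suc i) ≡ count χ (suc x)
      whole = trans (sym (count-block B (suc i)))
        (cong (count χ) (trans (+-suc (B * b) i) (cong suc (m/d*d+m%d≡m b x))))
      total≤n : ones B + count (block B) (suc i) ≤ n
      total≤n = ≤-trans (≤-reflexive whole) (count≤n (suc x))

    0<M : 0 < M
    0<M = ≤-<-trans z≤n n<M

    instance
      M≢0 : NonZero M
      M≢0 = >-nonZero 0<M

    sum<2^w : ∀ {i j} → i ≤ n → j ≤ M → i + j < 2 ^ w
    sum<2^w i≤n j≤M = <-≤-trans (+-mono-<-≤ (≤-<-trans i≤n n<M) j≤M) 2M≤2^w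

    reached⇒ : ∀ {e d i r} → e ⇒ i → d ⇒ r → i ≤ n → r ≤ n → reachedᴱ e d ⇒ (i + M ∸ r) / M
    reached⇒ {i = i} e⇒ d⇒ i≤n r≤n =
      div⇒ (sub⇒ (add⇒ e⇒ (parameter⇒ 6) (sum<2^w i≤n ≤-refl)) d⇒
             (≤-trans (≤-trans r≤n (<⇒≤ n<M)) (m≤n+m M i)) (sum<2^w i≤n ≤-refl))
        (parameter⇒ 6)

    reached-0 : ∀ {i r} → i < r → (i + M ∸ r) / M ≡ 0
    reached-0 {i} {r} i<r = m<n⇒m/n≡0 (m<n+o⇒m∸n<o (i + M) r (+-monoˡ-< M i<r))

    reached-1 : ∀ {i r} → i ≤ n → r ≤ i → (i + M ∸ r) / M ≡ 1
    reached-1 {i} {r} i≤n r≤i = ≤-antisym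
      (≤-pred (m<n*o⇒m/o<n {i + M ∸ r} {2} {M} (≤-<-trans (m∸n≤m (i + M) r)
        (<-≤-trans (+-monoˡ-< M (≤-<-trans i≤n n<M)) (≤-reflexive (cong (M +_) (sym (+-identityʳ M))))))))
      (m≥n⇒m/n>0 (m+n≤o⇒m≤o∸n M (≤-trans (+-monoʳ-≤ M r≤i) (≤-reflexive (+-comm M i)))))

    choose-0⇒ : ∀ {f e₁ e₀ v} → f ⇒ 0 → e₀ ⇒ v → v < 2 ^ w → chooseᴱ f e₁ e₀ ⇒ v
    choose-0⇒ {v = v} f⇒ e₀⇒ v< =
      add⇒ (0*⇒ f⇒) (mul⇒ (sub⇒ (#⇒ 1<2^w) f⇒ z≤n 1<2^w) e₀⇒ 1*v<) 1*v<
      as +-identityʳ v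
      where
      1*v< : 1 * v < 2 ^ w
      1*v< = ≤-<-trans (≤-reflexive (*-identityˡ v)) v<

    choose-1⇒ : ∀ {f e₁ e₀ v} → f ⇒ 1 → e₁ ⇒ v → v < 2 ^ w → chooseᴱ f e₁ e₀ ⇒ v
    choose-1⇒ {v = v} f⇒ e₁⇒ v< =
      add⇒ (mul⇒ f⇒ e₁⇒ (≤-<-trans (≤-reflexive (*-identityˡ v)) v<))
           (0*⇒ (sub⇒ (#⇒ 1<2^w) f⇒ ≤-refl 1<2^w))
           (≤-<-trans (≤-reflexive 1*v+0≡v) v<)
      as 1*v+0≡v
      where
      1*v+0≡v : 1 * v + 0 ≡ v
      1*v+0≡v = trans (+-identityʳ (1 * v)) (*-identityˡ v)

    N : ℕ
    N = suc lastBlock * b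

    module _ {i : ℕ} (i<m : i < count χ n) where

      i<n : i < n
      i<n = <-≤-trans i<m (count≤n n)

      pick<n : pick i < n
      pick<n = position-< χ N i<m

      blockOf≤ : blockOf i ≤ lastBlock
      blockOf≤ = /b≤lastBlock pick<n

      superOf≤ : superOf i ≤ lastSuper
      superOf≤ = /-monoˡ-≤ g blockOf≤

      superOf-fits : superOf i < 2 ^ w
      superOf-fits = ≤n⇒fits (≤-trans superOf≤ (≤-trans (m/n≤m lastBlock g) lastBlock≤))

      blockOf-fits : blockOf i < 2 ^ w
      blockOf-fits = ≤n⇒fits (≤-trans blockOf≤ lastBlock≤)

      i<ones-after : i < ones (suc (blockOf i))
      i<ones-after = begin-strict
        i                               <⟨ count-position-suc χ {N}
              (<-≤-trans i<m (psum-mono (indicator ∘ χ) (<⇒≤ (m<[1+m/d]*d b n)))) ⟩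
        count χ (suc (pick i))          ≤⟨ psum-mono (indicator ∘ χ) (m<[1+m/d]*d b (pick i)) ⟩
        count χ (suc (blockOf i) * b)   ≡⟨ ones-count (suc (blockOf i)) ⟨
        ones (suc (blockOf i)) ∎
        where open ≤-Reasoning

      i<ones-after-super : i < ones (suc (superOf i) * g)
      i<ones-after-super = <-≤-trans i<ones-after (psum-mono class (m<[1+m/d]*d g (blockOf i)))

    blockOf-mono : ∀ {i j} → i ≤ j → blockOf i ≤ blockOf j
    blockOf-mono i≤j = /-monoˡ-≤ b (position-mono χ N i≤j)

    superOf-mono : ∀ {i j} → i ≤ j → superOf i ≤ superOf j
    superOf-mono i≤j = /-monoˡ-≤ g (blockOf-mono i≤j)

    blockOf-< : ∀ {i B} → i < ones B → blockOf i < B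
    blockOf-< {i} {B} i< = m<n*o⇒m/o<n (position-< χ N (<-≤-trans i< (≤-reflexive (ones-count B))))

    superOf-< : ∀ {i s} → i < ones (s * g) → superOf i < s
    superOf-< i< = m<n*o⇒m/o<n (blockOf-< i<)

    first<m : ∀ {i} (d : ℕ) .{{_ : NonZero d}} → i < count χ n → i / d * d < count χ n
    first<m {i} d i<m = ≤-<-trans (m/n*n≤m i d) i<m

    group-index< : ∀ {i} (d : ℕ) .{{_ : NonZero d}} → i < n → i / d < n / d + 1
    group-index< {i} d i<n = ≤-<-trans (/-monoˡ-≤ d (<⇒≤ i<n)) (≤-reflexive (+-comm 1 (n / d)))

    -- If i comes before the end of the superblock s₀ in which its group starts, monotonicity forces
    -- `superOf i` to be s₀. Otherwise the group leaves s₀, and `same-group` shows that row s₀ lists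
    -- the answers for exactly this group. `blockOf⇒` repeats the argument one level down.
    superOf⇒ : ∀ {e i} → e ⇒ i → i < count χ n → superOfᴱ e ⇒ superOf i
    superOf⇒ {e} {i} e⇒ i<m = [ at-start , later ]′ (<-≤-connex i (ones (suc s₀ * g)))
      where
      s₀ : ℕ
      s₀ = superOf (i / G₁ * G₁)
      j<m : i / G₁ * G₁ < count χ n
      j<m = first<m G₁ i<m
      i≤n : i ≤ n
      i≤n = <⇒≤ (i<n i<m)
      s₀⇒ : entry 7 word (calc DIV e G₁ᴱ) ⇒ s₀
      s₀⇒ = entry⇒ 6 0<w ≤-refl word⇒ (div⇒ e⇒ (parameter⇒ 4)) (group-index< G₁ (i<n i<m)) (superOf-fits j<m)
      flag⇒ : reachedᴱ e (entry 1 word (next (entry 7 word (calc DIV e G₁ᴱ)))) ⇒ (i + M ∸ ones (suc s₀ * g)) / M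
      flag⇒ = reached⇒ e⇒
        (entry⇒ 0 0<w ≤-refl word⇒ (next⇒ s₀⇒ (≤-trans (superOf≤ j<m) (≤-trans (m/n≤m lastBlock g) lastBlock≤)))
          (≤-trans (s≤s (s≤s (superOf≤ j<m))) (≤-reflexive (+-comm 2 lastSuper)))
          (≤n⇒fits (ones≤n (suc s₀ * g)))) i≤n (ones≤n (suc s₀ * g))
      at-start : i < ones (suc s₀ * g) → superOfᴱ e ⇒ superOf i
      at-start i<r = choose-0⇒ (flag⇒ as reached-0 i<r) s₀⇒ (superOf-fits j<m)
        as ≤-antisym (superOf-mono (m/n*n≤m i G₁)) (≤-pred (superOf-< i<r))
      row : ℕ
      row = s₀ * G₁ + i % G₁
      row< : row < size 8
      row< = row-major< (≤-<-trans (superOf≤ j<m) (≤-reflexive (+-comm 1 lastSuper))) (m%n<n i G₁)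
      row<2^w : row < 2 ^ w
      row<2^w = <-trans row< (≤-<-trans (size≤total {8} (m≤m+n 9 3) 0<w) total<)
      later : ones (suc s₀ * g) ≤ i → superOfᴱ e ⇒ superOf i
      later r≤i = choose-1⇒ (flag⇒ as reached-1 i≤n r≤i)
        (entry⇒ 7 0<w ≤-refl word⇒
          (add⇒ (mul⇒ s₀⇒ (parameter⇒ 4) (≤-<-trans (m≤m+n (s₀ * G₁) (i % G₁)) row<2^w))
                (mod⇒ e⇒ (parameter⇒ 4)) row<2^w)
          row< (subst (_< 2 ^ w) (sym same) (superOf-fits i<m)) as same)
        (superOf-fits i<m)
        where
        same : content 8 row ≡ superOf i
        same = trans
          (cong₂ (λ s t → superOf (inGroup G₁ (ones (suc s * g)) t))
            ([q*d+r]/d≡q G₁ s₀ (m%n<n i G₁)) ([q*d+r]%d≡r G₁ s₀ (m%n<n i G₁)))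
          (cong superOf (same-group G₁ (i<ones-after-super j<m) r≤i))

    super+rest : ∀ i → superOf i * g + blockOf i % g ≡ blockOf i
    super+rest i = m/d*d+m%d≡m g (blockOf i)

    %g<2^β : ∀ B → B % g < 2 ^ β
    %g<2^β B = <-trans (m%n<n B g) (≤-<-trans (m≤m*n g (suc b)) relative<)

    blockOf-via-super⇒ : ∀ {e e′ i} → e ⇒ i → i < count χ n → e′ ⇒ blockOf i % g →
                         calc ADD (calc MUL (superOfᴱ e) gᴱ) e′ ⇒ blockOf i
    blockOf-via-super⇒ {i = i} e⇒ i<m e′⇒ =
      add⇒ (mul⇒ (superOf⇒ e⇒ i<m) (parameter⇒ 3) (≤-<-trans (m/n*n≤m (blockOf i) g) (blockOf-fits i<m))) e′⇒
           (≤-<-trans (≤-reflexive (super+rest i)) (blockOf-fits i<m))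
      as super+rest i

    blockOf⇒ : ∀ {e i} → e ⇒ i → i < count χ n → blockOfᴱ e ⇒ blockOf i
    blockOf⇒ {e} {i} e⇒ i<m = [ at-start , later ]′ (<-≤-connex i (ones (suc B₀)))
      where
      B₀ : ℕ
      B₀ = blockOf (i / G₂ * G₂)
      j<m : i / G₂ * G₂ < count χ n
      j<m = first<m G₂ i<m
      i≤n : i ≤ n
      i≤n = <⇒≤ (i<n i<m)
      qᴱ B₀ᴱ : Expr
      qᴱ = calc DIV e G₂ᴱ
      B₀ᴱ = calc ADD (calc MUL (superOfᴱ (calc MUL qᴱ G₂ᴱ)) gᴱ) (entry 9 βᴱ qᴱ)
      q⇒ : qᴱ ⇒ i / G₂
      q⇒ = div⇒ e⇒ (parameter⇒ 5)
      B₀⇒ : B₀ᴱ ⇒ B₀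
      B₀⇒ = blockOf-via-super⇒ (mul⇒ q⇒ (parameter⇒ 5) (≤n⇒fits (<⇒≤ (i<n j<m)))) j<m
        (entry⇒ 8 0<β β≤w (parameter⇒ 1) q⇒ (group-index< G₂ (i<n i<m)) (%g<2^β B₀))
      flag⇒ : reachedᴱ e (onesᴱ (next B₀ᴱ)) ⇒ (i + M ∸ ones (suc B₀)) / M
      flag⇒ = reached⇒ e⇒ (ones⇒ (next⇒ B₀⇒ (≤-trans (blockOf≤ j<m) lastBlock≤)) (s≤s (blockOf≤ j<m)))
        i≤n (ones≤n (suc B₀))
      at-start : i < ones (suc B₀) → blockOfᴱ e ⇒ blockOf i
      at-start i<r = choose-0⇒ (flag⇒ as reached-0 i<r) B₀⇒ (blockOf-fits j<m)
        as ≤-antisym (blockOf-mono (m/n*n≤m i G₂)) (≤-pred (blockOf-< i<r))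
      row : ℕ
      row = B₀ * G₂ + i % G₂
      row< : row < size 10
      row< = row-major< (≤-<-trans (blockOf≤ j<m) (≤-reflexive (+-comm 1 lastBlock))) (m%n<n i G₂)
      row<2^w : row < 2 ^ w
      row<2^w = <-trans row< (≤-<-trans (size≤total {10} (m≤m+n 11 1) 0<β) total<)
      later : ones (suc B₀) ≤ i → blockOfᴱ e ⇒ blockOf i
      later r≤i = choose-1⇒ (flag⇒ as reached-1 i≤n r≤i)
        (blockOf-via-super⇒ e⇒ i<m
          (entry⇒ 9 0<β β≤w (parameter⇒ 1)
            (add⇒ (mul⇒ B₀⇒ (parameter⇒ 5) (≤-<-trans (m≤m+n (B₀ * G₂) (i % G₂)) row<2^w))
                  (mod⇒ e⇒ (parameter⇒ 5)) row<2^w)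
            row< (subst (_< 2 ^ β) (sym same) (%g<2^β (blockOf i))) as same))
        (blockOf-fits i<m)
        where
        same : content 10 row ≡ blockOf i % g
        same = trans
          (cong₂ (λ B t → blockOf (inGroup G₂ (ones (suc B)) t) % g)
            ([q*d+r]/d≡q G₂ B₀ (m%n<n i G₂)) ([q*d+r]%d≡r G₂ B₀ (m%n<n i G₂)))
          (cong (λ k → blockOf k % g) (same-group G₂ (i<ones-after j<m) r≤i))

    -- With `ones B` ones before block B, the one sought has index i ∸ `ones B` inside the block;
    -- the counts on either side of y then fix the table entry through `position-unique`.
    select⇒ : ∀ {i} → x ≡ suc i → i < count χ n → selectᴱ ⇒ position χ N i
    select⇒ {i} refl i<m =
      add⇒ (mul⇒ B⇒ (parameter⇒ 2) (≤-<-trans (m/n*n≤m y b) y<2^w))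
           (lookup⇒ 5 B⇒ B≤ (sub⇒ i⇒ (ones⇒ B⇒ (m≤n⇒m≤1+n B≤)) ones≤i (≤n⇒fits (<⇒≤ (i<n i<m)))) j<b refl refl
             (subst (_< 2 ^ w) (sym found) (≤n⇒fits (≤-trans (m%n≤m y b) (<⇒≤ (pick<n i<m))))) as found)
           (≤-<-trans (≤-reflexive whole) y<2^w)
      as whole
      where
      y = pick i
      B = blockOf i
      r = y % b
      r<b : r < b
      r<b = m%n<n y b
      j = i ∸ ones B
      y<2^w : y < 2 ^ w
      y<2^w = ≤n⇒fits (<⇒≤ (pick<n i<m))
      i⇒ : calc SUB query (# 1) ⇒ i
      i⇒ = sub⇒ (query⇒ (≤n⇒fits (i<n i<m))) (#⇒ 1<2^w) (s≤s z≤n) (≤n⇒fits (i<n i<m))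
      B⇒ = blockOf⇒ i⇒ i<m
      B≤ = blockOf≤ i<m
      whole : B * b + r ≡ y
      whole = m/d*d+m%d≡m b y
      count-before : ones B + count (block B) r ≤ i
      count-before = begin
        ones B + count (block B) r  ≡⟨ count-block B r ⟨
        count χ (B * b + r)         ≡⟨ cong (count χ) whole ⟩
        count χ y                   ≤⟨ count-position χ N i ⟩
        i ∎
        where open ≤-Reasoning
      count-through : i < ones B + count (block B) (suc r)
      count-through = begin-strict
        i                           <⟨ count-position-suc χ {N}
              (<-≤-trans i<m (psum-mono (indicator ∘ χ) (<⇒≤ (m<[1+m/d]*d b n)))) ⟩
        count χ (suc y)             ≡⟨ cong (count χ) (trans (+-suc (B * b) r) (cong suc whole)) ⟨
        count χ (B * b + suc r)     ≡⟨ count-block B (suc r) ⟩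
        ones B + count (block B) (suc r) ∎
        where open ≤-Reasoning
      ones≤i : ones B ≤ i
      ones≤i = ≤-trans (m≤m+n (ones B) _) count-before
      j<-through : j < count (block B) (suc r)
      j<-through = +-cancelˡ-< (ones B) j _ (≤-<-trans (≤-reflexive (m+[n∸m]≡n ones≤i)) count-through)
      j<b : j < b
      j<b = <-≤-trans j<-through (≤-trans (count≤ (block B) (suc r)) r<b)
      before≤j : count (block B) r ≤ j
      before≤j = m+n≤o⇒m≤o∸n _ (≤-trans (≤-reflexive (+-comm _ (ones B))) count-before)
      found : content 6 (pattern-index B * b + j) ≡ r
      found = trans
        (cong₂ (λ p t → position (decodeAt p) b t) ([q*d+r]/d≡q b (pattern-index B) j<b)
            ([q*d+r]%d≡r b (pattern-index B) j<b))
        (position-unique (decodeAt (pattern-index B)) r<b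
          (≤-trans (≤-reflexive (count-decodeAt B (<⇒≤ r<b))) before≤j)
          (<-≤-trans j<-through (≤-reflexive (sym (count-decodeAt B r<b)))))

-- Exponential inequalities and the two cases of the space bound

module _ where

  open ≤-Reasoning

  ^-distribʳ-* : ∀ k x y → (x * y) ^ k ≡ x ^ k * y ^ k
  ^-distribʳ-* zero    x y = refl
  ^-distribʳ-* (suc k) x y = trans (cong (x * y *_) (^-distribʳ-* k x y)) (swap x y (x ^ k) (y ^ k))
    where
    swap : ∀ x y p q → x * y * (p * q) ≡ x * p * (y * q)
    swap = solve-∀

  -- With A = a + c this is (1 - c/A)^k ≥ 1 - k c/A, multiplied by A^(k+1) and freed of subtraction.
  bernoulli : ∀ a c k → (a + c) ^ k * (a + c) ≤ a ^ k * (a + c) + k * c * (a + c) ^ k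
  bernoulli a c zero    = m≤m+n _ 0
  bernoulli a c (suc k) = begin
    A * A ^ k * A                            ≡⟨ *-assoc A (A ^ k) A ⟩
    A * (A ^ k * A)                          ≤⟨ *-monoʳ-≤ A (bernoulli a c k) ⟩
    A * (a ^ k * A + k * c * A ^ k)          ≡⟨ expand a c k (a ^ k) (A ^ k) ⟩
    a * a ^ k * A + k * c * (A * A ^ k) + c * (A * a ^ k)
      ≤⟨ +-monoʳ-≤ (a * a ^ k * A + k * c * (A * A ^ k)) (*-monoʳ-≤ c (*-monoʳ-≤ A (^-monoˡ-≤ k (m≤m+n a c)))) ⟩
    a * a ^ k * A + k * c * (A * A ^ k) + c * (A * A ^ k) ≡⟨ collect (a * a ^ k * A) k c (A * A ^ k) ⟩
    a * a ^ k * A + suc k * c * (A * A ^ k) ∎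
    where
    A = a + c
    expand : ∀ a c k p q → (a + c) * (p * (a + c) + k * c * q) ≡ a * p * (a + c) + k * c * ((a + c) * q) + c * ((a + c) * p)
    expand = solve-∀
    collect : ∀ s k c q → s + k * c * q + c * q ≡ s + (1 + k) * c * q
    collect = solve-∀

  -- (1 + c/h)^h increases with h: Bernoulli's inequality for the quotient of two successive terms.
  growth : ∀ c h → (h + c) ^ h * suc h ^ suc h ≤ h ^ h * (suc h + c) ^ suc h
  growth c zero    = s≤s z≤n
  growth c h@(suc _) = *-cancelˡ-≤ (suc h * h * (h + c)) (begin
    suc h * h * (h + c) * ((h + c) ^ h * suc h ^ suc h)
      ≡⟨ regroup (suc h) h (h + c) ((h + c) ^ h) (suc h ^ suc h) ⟩
    suc h ^ suc h * ((h + c) * (h + c) ^ h) * (suc h * h)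
      ≡⟨ cong (_* (suc h * h)) (^-distribʳ-* (suc h) (suc h) (h + c)) ⟨
    (suc h * (h + c)) ^ suc h * (suc h * h)
      ≡⟨ cong (λ z → z ^ suc h * (suc h * h)) A≡ ⟩
    A ^ suc h * (suc h * h)
      -- Since A = (h+1)(h+c) = a + c, Bernoulli's lower bound for exponent h + 1 is 1 - c/(h+c) =
      -- h/(h+c).
      ≤⟨ +-cancelʳ-≤ (suc h * c * A ^ suc h) _ _ (begin
           A ^ suc h * (suc h * h) + suc h * c * A ^ suc h ≡⟨ gather (A ^ suc h) h c ⟩
           A ^ suc h * A                                   ≤⟨ bernoulli a c (suc h) ⟩
           a ^ suc h * A + suc h * c * A ^ suc h           ∎) ⟩
    a ^ suc h * A
      ≡⟨ cong₂ _*_ (^-distribʳ-* (suc h) h (suc h + c)) (sym A≡) ⟩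
    h * h ^ h * (suc h + c) ^ suc h * (suc h * (h + c))
      ≡⟨ regroup′ (suc h) h (h + c) (h ^ h) ((suc h + c) ^ suc h) ⟩
    suc h * h * (h + c) * (h ^ h * (suc h + c) ^ suc h) ∎)
    where
    a = h * (suc h + c)
    A = a + c
    A≡ : suc h * (h + c) ≡ A
    A≡ = eq h c
      where
      eq : ∀ h c → (1 + h) * (h + c) ≡ h * (1 + h + c) + c
      eq = solve-∀
    gather : ∀ q h c → q * ((1 + h) * h) + (1 + h) * c * q ≡ q * (h * (1 + h + c) + c)
    gather = solve-∀
    regroup : ∀ s h t p q → s * h * t * (p * q) ≡ q * (t * p) * (s * h)
    regroup = solve-∀
    regroup′ : ∀ s h t p q → h * p * q * (s * t) ≡ s * h * t * (p * q)
    regroup′ = solve-∀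

  -- For h = d + k this is 3^d ≤ (1 + 2d/h)^h: equality holds at h = d, and the right side increases
  -- with h by `growth`.
  3^d*h^h≤ : ∀ d k → 3 ^ d * (d + k) ^ (d + k) ≤ (d + k + 2 * d) ^ (d + k)
  3^d*h^h≤ d zero rewrite +-identityʳ d = ≤-reflexive
    (trans (sym (^-distribʳ-* d 3 d)) (cong (_^ d) (3d d)))
    where
    3d : ∀ d → 3 * d ≡ d + (d + d)
    3d = solve-∀
  3^d*h^h≤ d (suc k) rewrite +-suc d k with d + k in eq
  ... | zero    = begin
    3 ^ d * 1  ≡⟨ cong (λ d → 3 ^ d * 1) (m+n≡0⇒m≡0 d eq) ⟩
    1          ≤⟨ s≤s z≤n ⟩
    (1 + 2 * d) ^ 1 ∎
  ... | h@(suc _) = *-cancelˡ-≤ (h ^ h) {{m^n≢0 h h}} (begin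
    h ^ h * (3 ^ d * suc h ^ suc h)        ≡⟨ swap (h ^ h) (3 ^ d) (suc h ^ suc h) ⟩
    3 ^ d * h ^ h * suc h ^ suc h          ≤⟨ *-monoˡ-≤ (suc h ^ suc h)
          (subst (λ h → 3 ^ d * h ^ h ≤ (h + 2 * d) ^ h) eq (3^d*h^h≤ d k)) ⟩
    (h + 2 * d) ^ h * suc h ^ suc h        ≤⟨ growth (2 * d) h ⟩
    h ^ h * (suc h + 2 * d) ^ suc h        ∎)
    where
    swap : ∀ a b c → a * (b * c) ≡ b * a * c
    swap = solve-∀

  -- (1 + d/m)² ≥ 3^(d/m) for 0 ≤ d/m ≤ 2: equality holds at both ends and the left root is concave.
  3^d*m^2m≤ : ∀ m d → d ≤ 2 * m → 3 ^ d * m ^ (2 * m) ≤ (m + d) ^ (2 * m)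
  3^d*m^2m≤ m d d≤2m = *-cancelˡ-≤ (2 ^ h) {{m^n≢0 2 h}} (begin
    2 ^ h * (3 ^ d * m ^ h)      ≡⟨ swap (2 ^ h) (3 ^ d) (m ^ h) ⟩
    3 ^ d * (2 ^ h * m ^ h)      ≡⟨ cong (3 ^ d *_) (^-distribʳ-* h 2 m) ⟨
    3 ^ d * h ^ h                ≤⟨ subst (λ h → 3 ^ d * h ^ h ≤ (h + 2 * d) ^ h) (m+[n∸m]≡n d≤2m) (3^d*h^h≤ d (h ∸ d)) ⟩
    (h + 2 * d) ^ h              ≡⟨ cong (_^ h) (*-distribˡ-+ 2 m d) ⟨
    (2 * (m + d)) ^ h            ≡⟨ ^-distribʳ-* h 2 (m + d) ⟩
    2 ^ h * (m + d) ^ h          ∎)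
    where
    h = 2 * m
    swap : ∀ a b c → a * (b * c) ≡ b * (a * c)
    swap = solve-∀

  -- (1 + 1/x)^k ≤ 1 + k/x + (k/x)² for k ≤ x, without denominators
  compound : ∀ x k → k ≤ x → suc x ^ k * (x * x) ≤ x ^ k * (x * x + k * x + k * k)
  compound x zero    _   = ≤-reflexive (cong (1 *_) (sym (trans (+-identityʳ (x * x + 0)) (+-identityʳ (x * x)))))
  compound x (suc k) k<x = begin
    suc x * suc x ^ k * (x * x)     ≡⟨ *-assoc (suc x) (suc x ^ k) (x * x) ⟩
    suc x * (suc x ^ k * (x * x))   ≤⟨ *-monoʳ-≤ (suc x) (compound x k (<⇒≤ k<x)) ⟩
    suc x * (x ^ k * (x * x + k * x + k * k)) ≡⟨ swap (suc x) (x ^ k) (x * x + k * x + k * k) ⟩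
    x ^ k * (suc x * (x * x + k * x + k * k)) ≤⟨ *-monoʳ-≤ (x ^ k) (begin
      (1 + x) * (x * x + k * x + k * k)       ≡⟨ expand x k ⟩
      rest + k * k                            ≤⟨ +-monoʳ-≤ rest (*-monoʳ-≤ k (<⇒≤ k<x)) ⟩
      rest + k * x                            ≤⟨ +-monoʳ-≤ rest (m≤m+n (k * x) x) ⟩
      rest + (k * x + x)                      ≡⟨ collect x k ⟩
      x * (x * x + suc k * x + suc k * suc k) ∎) ⟩
    x ^ k * (x * (x * x + suc k * x + suc k * suc k)) ≡⟨ swap′ x (x ^ k) (x * x + suc k * x + suc k * suc k) ⟩
    x * x ^ k * (x * x + suc k * x + suc k * suc k) ∎
    where
    rest = x * x * x + k * x * x + k * k * x + x * x + k * x
    swap : ∀ a b c → a * (b * c) ≡ b * (a * c)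
    swap = solve-∀
    swap′ : ∀ a b c → b * (a * c) ≡ a * b * c
    swap′ = solve-∀
    expand : ∀ x k → (1 + x) * (x * x + k * x + k * k) ≡ x * x * x + k * x * x + k * k * x + x * x + k * x + k * k
    expand = solve-∀
    collect : ∀ x k → x * x * x + k * x * x + k * k * x + x * x + k * x + (k * x + x) ≡
                      x * (x * x + (1 + k) * x + (1 + k) * (1 + k))
    collect = solve-∀

  [1+x]^k≤3*x^k : ∀ x k .{{_ : NonZero x}} → k ≤ x → suc x ^ k ≤ 3 * x ^ k
  [1+x]^k≤3*x^k x k k≤x = *-cancelʳ-≤ _ _ (x * x) {{m*n≢0 x x}} (begin
    suc x ^ k * (x * x)                  ≤⟨ compound x k k≤x ⟩
    x ^ k * (x * x + k * x + k * k)      ≤⟨ *-monoʳ-≤ (x ^ k)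
          (+-mono-≤ (+-monoʳ-≤ (x * x) (*-monoˡ-≤ x k≤x)) (*-mono-≤ k≤x k≤x)) ⟩
    x ^ k * (x * x + x * x + x * x)      ≡⟨ collect (x ^ k) (x * x) ⟩
    3 * x ^ k * (x * x)                  ∎)
    where
    collect : ∀ p q → p * (q + q + q) ≡ 3 * p * q
    collect = solve-∀

  -- An integral form of (1 + m/d)^d ≤ e^m, with 3 in place of e. It bounds the cost of the zeros by
  -- log₂ 3 bits per element of the set.
  [m+d]^d≤3^m*d^d : ∀ m d .{{_ : NonZero d}} → (m + d) ^ d ≤ 3 ^ m * d ^ d
  [m+d]^d≤3^m*d^d zero    d = m≤m+n _ 0
  [m+d]^d≤3^m*d^d (suc m) d = begin
    suc (m + d) ^ d     ≤⟨ [1+x]^k≤3*x^k (m + d) d {{>-nonZero (<-≤-trans (>-nonZero⁻¹ d) (m≤n+m d m))}} (m≤n+m d m) ⟩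
    3 * (m + d) ^ d     ≤⟨ *-monoʳ-≤ 3 ([m+d]^d≤3^m*d^d m d) ⟩
    3 * (3 ^ m * d ^ d) ≡⟨ *-assoc 3 (3 ^ m) (d ^ d) ⟨
    3 * 3 ^ m * d ^ d   ∎

  -- The cost P of a code whose lengths are logarithms of class sizes, up to B
  -- bits of rounding, over m ones and d + r zeros, r ≤ b of them padding.
  module _ (P B b m d r : ℕ) (r≤b : r ≤ b) (1≤m : 1 ≤ m)
    (cost : ∀ x y → 2 ^ P * (x ^ m * y ^ (d + r)) ≤ 2 ^ B * (x + y) ^ (m + (d + r)))
    where

    private
      n = m + d
      SpaceGoal = 2 ^ (25 * P) * m ^ (36 * m) ≤ 2 ^ (25 * (m + (B + b))) * n ^ (36 * m)

    -- The uniform distribution on bits gives P ≤ B + n + b.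
    dense-space : d ≤ 2 * m → SpaceGoal
    dense-space d≤2m = begin
      2 ^ (25 * P) * m ^ (36 * m)
        ≤⟨ *-monoˡ-≤ (m ^ (36 * m)) (^-monoʳ-≤ 2 (*-monoʳ-≤ 25 P≤)) ⟩
      2 ^ (25 * (m + (B + b) + d)) * m ^ (36 * m)
        ≡⟨ cong (_* m ^ (36 * m)) (trans (cong (2 ^_) (*-distribˡ-+ 25 (m + (B + b)) d))
              (^-distribˡ-+-* 2 (25 * (m + (B + b))) (25 * d))) ⟩
      E * 2 ^ (25 * d) * m ^ (36 * m)
        ≡⟨ *-assoc E (2 ^ (25 * d)) (m ^ (36 * m)) ⟩
      E * (2 ^ (25 * d) * m ^ (36 * m))
        ≤⟨ *-monoʳ-≤ E (begin
             2 ^ (25 * d) * m ^ (36 * m)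
               ≡⟨ cong₂ _*_ (sym (^-*-assoc 2 25 d)) (cong (m ^_) 36m≡) ⟩
             (2 ^ 25) ^ d * m ^ (2 * m * 18)
               -- Here the constant 1.44 = 36/25 is tested at n = 3m: 2 ≤ 1.44 log₂ 3 says that 2^25
               -- ≤ 3^18.
               ≤⟨ *-monoˡ-≤ (m ^ (2 * m * 18)) (^-monoˡ-≤ d (≤ᵇ⇒≤ (2 ^ 25) (3 ^ 18) _)) ⟩
             (3 ^ 18) ^ d * m ^ (2 * m * 18)
               ≡⟨ cong₂ _*_ (trans (^-*-assoc 3 18 d) (trans (cong (3 ^_) (*-comm 18 d)) (sym (^-*-assoc 3 d 18))))
                     (sym (^-*-assoc m (2 * m) 18)) ⟩
             (3 ^ d) ^ 18 * (m ^ (2 * m)) ^ 18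
               ≡⟨ ^-distribʳ-* 18 (3 ^ d) (m ^ (2 * m)) ⟨
             (3 ^ d * m ^ (2 * m)) ^ 18
               ≤⟨ ^-monoˡ-≤ 18 (3^d*m^2m≤ m d d≤2m) ⟩
             (n ^ (2 * m)) ^ 18
               ≡⟨ ^-*-assoc n (2 * m) 18 ⟩
             n ^ (2 * m * 18)
               ≡⟨ cong (n ^_) 36m≡ ⟨
             n ^ (36 * m) ∎) ⟩
      E * n ^ (36 * m) ∎
      where
      E = 2 ^ (25 * (m + (B + b)))
      36m≡ : 36 * m ≡ 2 * m * 18
      36m≡ = trans (*-assoc 18 2 m) (*-comm 18 (2 * m))
      shuffle : ∀ m d b B → B + (m + (d + b)) ≡ m + (B + b) + d
      shuffle = solve-∀
      P≤ : P ≤ m + (B + b) + d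
      P≤ = ≮⇒≥ λ P> → <⇒≱ (^-monoʳ-< 2 (s≤s (s≤s z≤n)) P>) (begin
        2 ^ P                              ≡⟨ trans (sym (*-identityʳ (2 ^ P)))
              (cong (2 ^ P *_) (sym (cong₂ _*_ (^-zeroˡ m) (^-zeroˡ (d + r))))) ⟩
        2 ^ P * (1 ^ m * 1 ^ (d + r))      ≤⟨ cost 1 1 ⟩
        2 ^ B * 2 ^ (m + (d + r))          ≡⟨ ^-distribˡ-+-* 2 B (m + (d + r)) ⟨
        2 ^ (B + (m + (d + r)))            ≤⟨ ^-monoʳ-≤ 2 (+-monoʳ-≤ B (+-monoʳ-≤ m (+-monoʳ-≤ d r≤b))) ⟩
        2 ^ (B + (m + (d + b)))            ≡⟨ cong (2 ^_) (shuffle m d b B) ⟩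
        2 ^ (m + (B + b) + d)              ∎)

    -- The distribution with weights m/n and d/n gives m log₂ (n/m) + m log₂ 3, and 3 ≤ n/m.
    sparse-space : 2 * m ≤ d → SpaceGoal
    sparse-space 2m≤d = begin
      2 ^ (25 * P) * m ^ (36 * m)
        ≡⟨ cong₂ _*_ (trans (cong (2 ^_) (*-comm 25 P)) (sym (^-*-assoc 2 P 25)))
                     (trans (cong (m ^_) (36m m)) (trans (^-distribˡ-+-* m (m * 25) (11 * m))
                           (cong (_* m ^ (11 * m)) (sym (^-*-assoc m m 25))))) ⟩
      (2 ^ P) ^ 25 * ((m ^ m) ^ 25 * m ^ (11 * m))
        ≡⟨ trans (sym (*-assoc ((2 ^ P) ^ 25) _ _)) (cong (_* m ^ (11 * m)) (sym (^-distribʳ-* 25 (2 ^ P) (m ^ m)))) ⟩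
      (2 ^ P * m ^ m) ^ 25 * m ^ (11 * m)
        ≤⟨ *-monoˡ-≤ (m ^ (11 * m)) (^-monoˡ-≤ 25 cancelled) ⟩
      (F * (n ^ m * 3 ^ m)) ^ 25 * m ^ (11 * m)
        ≡⟨ cong (_* m ^ (11 * m)) (trans (^-distribʳ-* 25 F (n ^ m * 3 ^ m))
              (cong (F ^ 25 *_) (^-distribʳ-* 25 (n ^ m) (3 ^ m)))) ⟩
      F ^ 25 * ((n ^ m) ^ 25 * (3 ^ m) ^ 25) * m ^ (11 * m)
        ≡⟨ regroup (F ^ 25) ((n ^ m) ^ 25) ((3 ^ m) ^ 25) (m ^ (11 * m)) ⟩
      F ^ 25 * (n ^ m) ^ 25 * ((3 ^ m) ^ 25 * m ^ (11 * m))
        ≤⟨ *-monoʳ-≤ (F ^ 25 * (n ^ m) ^ 25) (begin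
             (3 ^ m) ^ 25 * m ^ (11 * m)
               ≡⟨ cong (_* m ^ (11 * m)) (trans (^-*-assoc 3 m 25)
                     (trans (cong (3 ^_) (25m m)) (trans (^-distribˡ-+-* 3 (14 * m) (11 * m))
                     (cong (_* 3 ^ (11 * m)) (sym (^-*-assoc 3 14 m)))))) ⟩
             (3 ^ 14) ^ m * 3 ^ (11 * m) * m ^ (11 * m)
               ≡⟨ trans (*-assoc ((3 ^ 14) ^ m) _ _) (cong ((3 ^ 14) ^ m *_) (sym (^-distribʳ-* (11 * m) 3 m))) ⟩
             (3 ^ 14) ^ m * (3 * m) ^ (11 * m)
               -- Of the 36 = 25 + 11 powers of (n/m)^m, the code itself uses 25. The other 11
               -- absorb 11 of the 25 factors 3^m because 3m ≤ n, and 3^14 ≤ 2^25 pays for the rest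
               -- out of the term m.
               ≤⟨ *-mono-≤ (^-monoˡ-≤ m (≤ᵇ⇒≤ (3 ^ 14) (2 ^ 25) _)) (^-monoˡ-≤ (11 * m) (+-monoʳ-≤ m 2m≤d)) ⟩
             (2 ^ 25) ^ m * n ^ (11 * m) ∎) ⟩
      F ^ 25 * (n ^ m) ^ 25 * ((2 ^ 25) ^ m * n ^ (11 * m))
        ≡⟨ cong₂ (λ u v → u * v * ((2 ^ 25) ^ m * n ^ (11 * m)))
              (trans (^-*-assoc 2 (B + b) 25) (cong (2 ^_) (*-comm (B + b) 25))) (^-*-assoc n m 25) ⟩
      2 ^ (25 * (B + b)) * n ^ (m * 25) * ((2 ^ 25) ^ m * n ^ (11 * m))
        ≡⟨ cong (λ u → 2 ^ (25 * (B + b)) * n ^ (m * 25) * (u * n ^ (11 * m))) (^-*-assoc 2 25 m) ⟩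
      2 ^ (25 * (B + b)) * n ^ (m * 25) * (2 ^ (25 * m) * n ^ (11 * m))
        ≡⟨ regroup′ (2 ^ (25 * (B + b))) (n ^ (m * 25)) (2 ^ (25 * m)) (n ^ (11 * m)) ⟩
      2 ^ (25 * m) * 2 ^ (25 * (B + b)) * (n ^ (m * 25) * n ^ (11 * m))
        ≡⟨ cong₂ _*_ (sym (trans (cong (2 ^_) (*-distribˡ-+ 25 m (B + b))) (^-distribˡ-+-* 2 (25 * m) (25 * (B + b)))))
                     (sym (trans (cong (n ^_) (36m m)) (^-distribˡ-+-* n (m * 25) (11 * m)))) ⟩
      2 ^ (25 * (m + (B + b))) * n ^ (36 * m) ∎
      where
      F = 2 ^ (B + b)
      36m : ∀ m → 36 * m ≡ m * 25 + 11 * m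
      36m = solve-∀
      25m : ∀ m → m * 25 ≡ 14 * m + 11 * m
      25m = solve-∀
      regroup : ∀ f a c k → f * (a * c) * k ≡ f * a * (c * k)
      regroup = solve-∀
      regroup′ : ∀ f a c k → f * a * (c * k) ≡ c * f * (a * k)
      regroup′ = solve-∀
      m≤d : m ≤ d
      m≤d = ≤-trans (m≤m+n m _) 2m≤d
      instance
        d≢0 : NonZero d
        d≢0 = >-nonZero (≤-trans 1≤m m≤d)
      n≤2d : n ≤ 2 * d
      n≤2d = ≤-trans (+-monoˡ-≤ d m≤d) (≤-reflexive (cong (d +_) (sym (+-identityʳ d))))
      -- As zeros have weight d/n ≥ 1/2, each padding zero costs at most one bit.
      n^r≤ : n ^ r ≤ 2 ^ b * d ^ r
      n^r≤ = begin
        n ^ r          ≤⟨ ^-monoˡ-≤ r n≤2d ⟩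
        (2 * d) ^ r    ≡⟨ ^-distribʳ-* r 2 d ⟩
        2 ^ r * d ^ r  ≤⟨ *-monoˡ-≤ (d ^ r) (^-monoʳ-≤ 2 r≤b) ⟩
        2 ^ b * d ^ r  ∎
      cancelled : 2 ^ P * m ^ m ≤ F * (n ^ m * 3 ^ m)
      cancelled = *-cancelʳ-≤ _ _ (d ^ (d + r)) {{m^n≢0 d (d + r)}} (begin
        2 ^ P * m ^ m * d ^ (d + r)         ≡⟨ *-assoc (2 ^ P) (m ^ m) (d ^ (d + r)) ⟩
        2 ^ P * (m ^ m * d ^ (d + r))       ≤⟨ cost m d ⟩
        2 ^ B * n ^ (m + (d + r))           ≡⟨ cong (2 ^ B *_)
              (trans (^-distribˡ-+-* n m (d + r)) (cong (n ^ m *_) (^-distribˡ-+-* n d r))) ⟩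
        2 ^ B * (n ^ m * (n ^ d * n ^ r))   ≤⟨ *-monoʳ-≤ (2 ^ B) (*-monoʳ-≤ (n ^ m) (*-mono-≤ ([m+d]^d≤3^m*d^d m d) n^r≤)) ⟩
        2 ^ B * (n ^ m * (3 ^ m * d ^ d * (2 ^ b * d ^ r))) ≡⟨ arrange (2 ^ B) (n ^ m) (3 ^ m) (d ^ d) (2 ^ b) (d ^ r) ⟩
        2 ^ B * 2 ^ b * (n ^ m * 3 ^ m) * (d ^ d * d ^ r)   ≡⟨ cong₂ (λ u v → u * (n ^ m * 3 ^ m) * v)
            (^-distribˡ-+-* 2 B b) (^-distribˡ-+-* d d r) ⟨
        F * (n ^ m * 3 ^ m) * d ^ (d + r)   ∎)
        where
        arrange : ∀ p q s t u v → p * (q * (s * t * (u * v))) ≡ p * u * (q * s) * (t * v)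
        arrange = solve-∀

    space : SpaceGoal
    space with ≤-total d (2 * m)
    ... | inj₁ d≤2m = dense-space d≤2m
    ... | inj₂ 2m≤d = sparse-space 2m≤d

-- Bounds on the redundancy

module _ where

  open ≤-Reasoning

  x<8*[1+x/8] : ∀ x → x < 8 * suc (x / 8)
  x<8*[1+x/8] x = begin-strict
    x                   ≡⟨ m≡m%n+[m/n]*n x 8 ⟩
    x % 8 + x / 8 * 8   <⟨ +-monoˡ-< (x / 8 * 8) (m%n<n x 8) ⟩
    8 + x / 8 * 8       ≡⟨ *-comm (suc (x / 8)) 8 ⟩
    8 * suc (x / 8)     ∎

  -- From x ≤ 8 · 2^(x/8): a fourth power is paid for by about half of the exponent in 2^x. It is
  -- applied both to u and to L.
  quartic≤ : ∀ x → x * x * (x * x) ≤ 2 ^ 12 * 2 ^ (4 * (x / 8))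
  quartic≤ x = begin
    x * x * (x * x)                     ≤⟨ *-mono-≤ (*-mono-≤ x≤ x≤) (*-mono-≤ x≤ x≤) ⟩
    8 * y * (8 * y) * (8 * y * (8 * y)) ≡⟨ expand 8 y ⟩
    8 * 8 * (8 * 8) * (y * (y * (y * (y * 1)))) ≡⟨ cong (2 ^ 12 *_)
          (trans (^-*-assoc 2 (x / 8) 4) (cong (2 ^_) (*-comm (x / 8) 4))) ⟩
    2 ^ 12 * 2 ^ (4 * (x / 8))          ∎
    where
    y = 2 ^ (x / 8)
    x≤ : x ≤ 8 * y
    x≤ = ≤-trans (<⇒≤ (x<8*[1+x/8] x)) (*-monoʳ-≤ 8 (n<2^n (x / 8)))
    expand : ∀ e y → e * y * (e * y) * (e * y * (e * y)) ≡ e * e * (e * e) * (y * (y * (y * (y * 1))))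
    expand = solve-∀

  -- c is the factor wordFactor; q and s stand for the indices of the last block and superblock.
  module Overhead
    (n L u b q s c : ℕ) (1≤L : 1 ≤ L) (1≤u : 1 ≤ u) (u≤L : u ≤ L) (1≤b : 1 ≤ b) (b≤L : b ≤ L)
    (s*L²≤q : s * (L * L) ≤ q) (q≤n : q ≤ n) where

    -- Each size is multiplied by u and then compared with X; as X is O(n), this gives O(n/u). A
    -- comes from the explicit rows of blocks, u² entries of 3u bits per block; D comes from the
    -- tables and also dominates all terms polynomial in L and u.
    A D X : ℕ
    A = q * (u * u * (u * u))
    D = L * L * (L * L) * 2 ^ b
    X = n + A + D

    n≤X : n ≤ X
    n≤X = ≤-trans (m≤m+n n A) (m≤m+n (n + A) D)

    A≤X : A ≤ X
    A≤X = ≤-trans (m≤n+m A n) (m≤m+n (n + A) D)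

    D≤X : D ≤ X
    D≤X = m≤n+m D (n + A)

    1≤L² : 1 ≤ L * L
    1≤L² = *-mono-≤ 1≤L 1≤L

    1≤u² : 1 ≤ u * u
    1≤u² = *-mono-≤ 1≤u 1≤u

    ≤-*ˡ : ∀ {k} m → 1 ≤ k → m ≤ k * m
    ≤-*ˡ m 1≤k = ≤-trans (≤-reflexive (sym (*-identityˡ m))) (*-monoˡ-≤ m 1≤k)

    ≤-*ʳ : ∀ {k} m → 1 ≤ k → m ≤ m * k
    ≤-*ʳ m 1≤k = ≤-trans (≤-reflexive (sym (*-identityʳ m))) (*-monoʳ-≤ m 1≤k)

    L⁴≤D : L * L * (L * L) ≤ D
    L⁴≤D = ≤-*ʳ _ (m^n>0 2 b)

    L²≤D : L * L ≤ D
    L²≤D = ≤-trans (≤-*ˡ (L * L) 1≤L²) L⁴≤D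

    L≤D : L ≤ D
    L≤D = ≤-trans (≤-*ˡ L 1≤L) L²≤D

    L*u≤D : L * u ≤ D
    L*u≤D = ≤-trans (*-monoʳ-≤ L u≤L) L²≤D

    u²≤D : u * u ≤ D
    u²≤D = ≤-trans (*-mono-≤ u≤L u≤L) L²≤D

    u⁴≤D : u * u * (u * u) ≤ D
    u⁴≤D = ≤-trans (*-mono-≤ (*-mono-≤ u≤L u≤L) (*-mono-≤ u≤L u≤L)) L⁴≤D

    L²u²≤D : L * L * (u * u) ≤ D
    L²u²≤D = ≤-trans (*-monoʳ-≤ (L * L) (*-mono-≤ u≤L u≤L)) L⁴≤D

    q*u²≤A : q * (u * u) ≤ A
    q*u²≤A = *-monoʳ-≤ q (≤-*ˡ (u * u) 1≤u²)

    q*u≤A : q * u ≤ A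
    q*u≤A = ≤-trans (*-monoʳ-≤ q (≤-*ˡ u 1≤u)) q*u²≤A

    header≤ : 19 * (c * L) * u ≤ 19 * c * X
    header≤ = begin
      19 * (c * L) * u  ≡⟨ shuffle 19 c L u ⟩
      19 * c * (L * u)  ≤⟨ *-monoʳ-≤ (19 * c) (≤-trans L*u≤D D≤X) ⟩
      19 * c * X        ∎
      where
      shuffle : ∀ k c L u → k * (c * L) * u ≡ k * c * (L * u)
      shuffle = solve-∀

    super≤ : (s + 2) * (c * L) * u ≤ 3 * c * X
    super≤ = begin
      (s + 2) * (c * L) * u          ≡⟨ shuffle s c L u ⟩
      c * (s * (L * u) + 2 * (L * u)) ≤⟨ *-monoʳ-≤ c (+-mono-≤ (begin
        s * (L * u) ≤⟨ *-monoʳ-≤ s (*-monoʳ-≤ L u≤L) ⟩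
        s * (L * L) ≤⟨ ≤-trans s*L²≤q q≤n ⟩
        n           ≤⟨ n≤X ⟩
        X           ∎) (*-monoʳ-≤ 2 (≤-trans L*u≤D D≤X))) ⟩
      c * (X + 2 * X)                ≡⟨ collect c X ⟩
      3 * c * X                      ∎
      where
      shuffle : ∀ s c L u → (s + 2) * (c * L) * u ≡ c * (s * (L * u) + 2 * (L * u))
      shuffle = solve-∀
      collect : ∀ c X → c * (X + 2 * X) ≡ 3 * c * X
      collect = solve-∀

    block≤ : (q + 2) * (3 * u) * u ≤ 9 * X
    block≤ = begin
      (q + 2) * (3 * u) * u               ≡⟨ shuffle q u ⟩
      3 * (q * (u * u)) + 6 * (u * u)     ≤⟨ +-mono-≤ (*-monoʳ-≤ 3 (≤-trans q*u²≤A A≤X)) (*-monoʳ-≤ 6 (≤-trans u²≤D D≤X)) ⟩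
      3 * X + 6 * X                       ≡⟨ *-distribʳ-+ X 3 6 ⟨
      9 * X                               ∎
      where
      shuffle : ∀ q u → (q + 2) * (3 * u) * u ≡ 3 * (q * (u * u)) + 6 * (u * u)
      shuffle = solve-∀

    table≤ : suc b * 2 ^ b * b * (c * L) * u ≤ 2 * c * X
    table≤ = begin
      suc b * 2 ^ b * b * (c * L) * u     ≤⟨ *-mono-≤ (*-monoˡ-≤ (c * L) (*-mono-≤ (*-monoˡ-≤ (2 ^ b) suc-b≤) b≤L)) u≤L ⟩
      (L + L) * 2 ^ b * L * (c * L) * L   ≡⟨ shuffle L (2 ^ b) c ⟩
      2 * c * D                           ≤⟨ *-monoʳ-≤ (2 * c) D≤X ⟩
      2 * c * X                           ∎
      where
      suc-b≤ : suc b ≤ L + L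
      suc-b≤ = +-mono-≤ 1≤L b≤L
      shuffle : ∀ L p c → (L + L) * p * L * (c * L) * L ≡ 2 * c * (L * L * (L * L) * p)
      shuffle = solve-∀

    group₁≤ : ∀ t → t * (L * u) ≤ n → (t + 1) * (c * L) * u ≤ 2 * c * X
    group₁≤ t t≤ = begin
      (t + 1) * (c * L) * u           ≡⟨ shuffle t c L u ⟩
      c * (t * (L * u) + L * u)       ≤⟨ *-monoʳ-≤ c (+-mono-≤ (≤-trans t≤ n≤X) (≤-trans L*u≤D D≤X)) ⟩
      c * (X + X)                     ≡⟨ collect c X ⟩
      2 * c * X                       ∎
      where
      shuffle : ∀ t c L u → (t + 1) * (c * L) * u ≡ c * (t * (L * u) + L * u)
      shuffle = solve-∀
      collect : ∀ c X → c * (X + X) ≡ 2 * c * X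
      collect = solve-∀

    explicit₁≤ : (s + 1) * (L * u) * (c * L) * u ≤ 2 * c * X
    explicit₁≤ = begin
      (s + 1) * (L * u) * (c * L) * u ≡⟨ shuffle s c L u ⟩
      c * (s * (L * L) * (u * u) + L * L * (u * u))
        ≤⟨ *-monoʳ-≤ c (+-mono-≤ (≤-trans (*-monoˡ-≤ (u * u) s*L²≤q) (≤-trans q*u²≤A A≤X)) (≤-trans L²u²≤D D≤X)) ⟩
      c * (X + X)                     ≡⟨ collect c X ⟩
      2 * c * X                       ∎
      where
      shuffle : ∀ s c L u → (s + 1) * (L * u) * (c * L) * u ≡ c * (s * (L * L) * (u * u) + L * L * (u * u))
      shuffle = solve-∀
      collect : ∀ c X → c * (X + X) ≡ 2 * c * X
      collect = solve-∀

    group₂≤ : ∀ t → t * (u * u) ≤ n → (t + 1) * (3 * u) * u ≤ 6 * X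
    group₂≤ t t≤ = begin
      (t + 1) * (3 * u) * u           ≡⟨ shuffle t u ⟩
      3 * (t * (u * u)) + 3 * (u * u) ≤⟨ +-mono-≤ (*-monoʳ-≤ 3 (≤-trans t≤ n≤X)) (*-monoʳ-≤ 3 (≤-trans u²≤D D≤X)) ⟩
      3 * X + 3 * X                   ≡⟨ *-distribʳ-+ X 3 3 ⟨
      6 * X                           ∎
      where
      shuffle : ∀ t u → (t + 1) * (3 * u) * u ≡ 3 * (t * (u * u)) + 3 * (u * u)
      shuffle = solve-∀

    explicit₂≤ : (q + 1) * (u * u) * (3 * u) * u ≤ 6 * X
    explicit₂≤ = begin
      (q + 1) * (u * u) * (3 * u) * u ≡⟨ shuffle q u ⟩
      3 * A + 3 * (u * u * (u * u))   ≤⟨ +-mono-≤ (*-monoʳ-≤ 3 A≤X) (*-monoʳ-≤ 3 (≤-trans u⁴≤D D≤X)) ⟩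
      3 * X + 3 * X                   ≡⟨ *-distribʳ-+ X 3 3 ⟨
      6 * X                           ∎
      where
      shuffle : ∀ q u → (q + 1) * (u * u) * (3 * u) * u ≡ 3 * (q * (u * u * (u * u))) + 3 * (u * u * (u * u))
      shuffle = solve-∀

    rounding≤ : (suc q + b) * u ≤ 3 * X
    rounding≤ = begin
      (suc q + b) * u      ≡⟨ shuffle q b u ⟩
      u + (q * u + b * u)  ≤⟨ +-mono-≤ (≤-trans u≤L (≤-trans L≤D D≤X))
            (+-mono-≤ (≤-trans q*u≤A A≤X) (≤-trans (*-monoˡ-≤ u b≤L) (≤-trans L*u≤D D≤X))) ⟩
      X + (X + X)          ≡⟨ collect X ⟩
      3 * X                ∎
      where
      shuffle : ∀ q b u → (1 + q + b) * u ≡ u + (q * u + b * u)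
      shuffle = solve-∀
      collect : ∀ X → X + (X + X) ≡ 3 * X
      collect = solve-∀

    A≤2^16*n : q * b ≤ n → 2 ^ u ≤ 2 * L → L ≤ 8 * b → A ≤ 2 ^ 16 * n
    A≤2^16*n q*b≤n 2^u≤2L L≤8b = begin
      q * (u * u * (u * u))            ≤⟨ *-monoʳ-≤ q (quartic≤ u) ⟩
      q * (2 ^ 12 * 2 ^ (4 * (u / 8))) ≤⟨ *-monoʳ-≤ q (*-monoʳ-≤ (2 ^ 12) (^-monoʳ-≤ 2 4*[u/8]≤u)) ⟩
      q * (2 ^ 12 * 2 ^ u)             ≤⟨ *-monoʳ-≤ q (*-monoʳ-≤ (2 ^ 12) (≤-trans 2^u≤2L (*-monoʳ-≤ 2 L≤8b))) ⟩
      q * (2 ^ 12 * (2 * (8 * b)))     ≡⟨ shuffle q b (2 ^ 12) ⟩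
      16 * 2 ^ 12 * (q * b)            ≤⟨ *-monoʳ-≤ (16 * 2 ^ 12) q*b≤n ⟩
      16 * 2 ^ 12 * n                  ∎
      where
      4*[u/8]≤u : 4 * (u / 8) ≤ u
      4*[u/8]≤u = ≤-trans (*-monoˡ-≤ (u / 8) (s≤s (s≤s (s≤s (s≤s (z≤n {4}))))))
                    (≤-trans (≤-reflexive (*-comm 8 (u / 8))) (m/n*n≤m u 8))
      shuffle : ∀ q b p → q * (p * (2 * (8 * b))) ≡ 16 * p * (q * b)
      shuffle = solve-∀

    -- The reason for the eighth in the block size: four eighths of the exponent L pay for L⁴ and
    -- one more for 2 ^ b, while 2 ^ L ≤ 2n.
    D≤2^14*n : b ≡ suc (L / 8) → 2 ^ L ≤ 2 * n → D ≤ 2 ^ 14 * n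
    D≤2^14*n refl 2^L≤2n = begin
      L * L * (L * L) * 2 ^ b                   ≤⟨ *-monoˡ-≤ (2 ^ b) (quartic≤ L) ⟩
      2 ^ 12 * 2 ^ (4 * (L / 8)) * (2 * 2 ^ (L / 8)) ≡⟨ shuffle (2 ^ 12) (2 ^ (4 * (L / 8))) (2 ^ (L / 8)) ⟩
      2 * 2 ^ 12 * (2 ^ (L / 8) * 2 ^ (4 * (L / 8))) ≡⟨ cong (2 * 2 ^ 12 *_) (^-distribˡ-+-* 2 (L / 8) (4 * (L / 8))) ⟨
      2 * 2 ^ 12 * 2 ^ (5 * (L / 8))            ≤⟨ *-monoʳ-≤ (2 * 2 ^ 12) (^-monoʳ-≤ 2 5*[L/8]≤L) ⟩
      2 * 2 ^ 12 * 2 ^ L                        ≤⟨ *-monoʳ-≤ (2 * 2 ^ 12) 2^L≤2n ⟩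
      2 * 2 ^ 12 * (2 * n)                      ≡⟨ collect (2 * 2 ^ 12) n ⟩
      2 * (2 * 2 ^ 12) * n                      ∎
      where
      5*[L/8]≤L : 5 * (L / 8) ≤ L
      5*[L/8]≤L = ≤-trans (*-monoˡ-≤ (L / 8) (s≤s (s≤s (s≤s (s≤s (s≤s (z≤n {3})))))))
                    (≤-trans (≤-reflexive (*-comm 8 (L / 8))) (m/n*n≤m L 8))
      shuffle : ∀ p q r → p * q * (2 * r) ≡ 2 * p * (r * q)
      shuffle = solve-∀
      collect : ∀ p n → p * (2 * n) ≡ 2 * p * n
      collect = solve-∀

-- The total length of the block codes

psum-add : ∀ f g k → psum f k + psum g k ≡ psum (λ i → f i + g i) k
psum-add f g zero    = refl
psum-add f g (suc k) = trans (swap (psum f k) (f k) (psum g k) (g k)) (cong (_+ (f k + g k)) (psum-add f g k))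
  where
  swap : ∀ a b c d → a + b + (c + d) ≡ a + c + (b + d)
  swap = solve-∀

module Cost (b : ℕ) (χ : ℕ → Bool) where

  open Blocks b χ

  zeros : ℕ → ℕ
  zeros = psum (λ B → b ∸ class B)

  ones+zeros : ∀ B → ones B + zeros B ≡ B * b
  ones+zeros B = trans (psum-add class (λ B → b ∸ class B) B)
    (trans (psum-cong B (λ {i} _ → m+[n∸m]≡n (class≤ i))) (psum-const b B))

  block-cost : ∀ x y B → 2 ^ len B * (x ^ class B * y ^ (b ∸ class B)) ≤ 2 * (x + y) ^ b
  block-cost x y B = begin
    2 * 2 ^ ⌊log₂ (b choose k) ⌋ * (x ^ k * y ^ (b ∸ k)) ≤⟨ *-monoˡ-≤ _ (*-monoʳ-≤ 2 (proj₁ (log-choose B))) ⟩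
    2 * (b choose k) * (x ^ k * y ^ (b ∸ k))             ≡⟨ *-assoc 2 (b choose k) _ ⟩
    2 * ((b choose k) * (x ^ k * y ^ (b ∸ k)))
      ≤⟨ *-monoʳ-≤ 2 (subst (λ n → (n choose k) * (x ^ k * y ^ (b ∸ k)) ≤ (x + y) ^ n) (m+[n∸m]≡n (class≤ B))
            (binomial-term≤ x y k (b ∸ k))) ⟩
    2 * (x + y) ^ b ∎
    where
    open ≤-Reasoning
    k = class B

  -- The product of `block-cost` over the blocks. The weights x and y are common to all blocks, so
  -- the exponents add up to the global numbers of ones and zeros, however unevenly the ones are
  -- spread.
  stream-cost : ∀ B x y → 2 ^ pos B * (x ^ ones B * y ^ zeros B) ≤ 2 ^ B * (x + y) ^ (B * b)
  stream-cost zero    x y = ≤-refl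
  stream-cost (suc B) x y = begin
    2 ^ (pos B + len B) * (x ^ (ones B + class B) * y ^ (zeros B + (b ∸ class B)))
      ≡⟨ cong₂ _*_ (^-distribˡ-+-* 2 (pos B) (len B))
           (cong₂ _*_ (^-distribˡ-+-* x (ones B) (class B)) (^-distribˡ-+-* y (zeros B) (b ∸ class B))) ⟩
    2 ^ pos B * 2 ^ len B * (x ^ ones B * x ^ class B * (y ^ zeros B * y ^ (b ∸ class B)))
      ≡⟨ regroup (2 ^ pos B) (2 ^ len B) (x ^ ones B) (x ^ class B) (y ^ zeros B) (y ^ (b ∸ class B)) ⟩
    2 ^ pos B * (x ^ ones B * y ^ zeros B) * (2 ^ len B * (x ^ class B * y ^ (b ∸ class B)))
      ≤⟨ *-mono-≤ (stream-cost B x y) (block-cost x y B) ⟩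
    2 ^ B * (x + y) ^ (B * b) * (2 * (x + y) ^ b)
      ≡⟨ regroup′ (2 ^ B) ((x + y) ^ (B * b)) ((x + y) ^ b) ⟩
    2 * 2 ^ B * ((x + y) ^ b * (x + y) ^ (B * b))
      ≡⟨ cong (2 * 2 ^ B *_) (^-distribˡ-+-* (x + y) b (B * b)) ⟨
    2 ^ suc B * (x + y) ^ (suc B * b) ∎
    where
    open ≤-Reasoning
    regroup : ∀ p q s t u v → p * q * (s * t * (u * v)) ≡ p * (s * u) * (q * (t * v))
    regroup = solve-∀
    regroup′ : ∀ p q r → p * q * (2 * r) ≡ 2 * p * (r * q)
    regroup′ = solve-∀

count-member≤ : ∀ {n} (S : Subset n) y → count (member S) y ≤ ∣ S ∣
count-member≤ S       zero    = z≤n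
count-member≤ []      (suc y) = ≤-trans (≤-reflexive (+-identityʳ _)) (count-member≤ [] y)
count-member≤ (s ∷ S) (suc y) = ≤-trans (≤-reflexive (count-member-∷ s S y))
  (≤-trans (+-monoʳ-≤ (indicator s) (count-member≤ S y)) (≤-reflexive (sym (size-∷ s S))))

count-member-≥ : ∀ {n} (S : Subset n) {y} → n ≤ y → count (member S) y ≡ ∣ S ∣
count-member-≥ S {y} n≤y = ≤-antisym (count-member≤ S y)
  (≤-trans (≤-reflexive (size-count S)) (psum-mono (indicator ∘ member S) n≤y))

-- The choice of parameters

module Parameters
  (n L u b : ℕ) (1≤n : 1 ≤ n) (n<2^L : n < 2 ^ L) (2^L≤2n : 2 ^ L ≤ 2 * n)
  (1≤L : 1 ≤ L) (L<2^u : L < 2 ^ u) (2^u≤2L : 2 ^ u ≤ 2 * L) (1≤u : 1 ≤ u) (u≤L : u ≤ L)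
  (1≤b : 1 ≤ b) (b≤L : b ≤ L) (b≡ : b ≡ suc (L / 8))
  where

  instance
    L≢0 : NonZero L
    L≢0 = >-nonZero 1≤L
    u≢0 : NonZero u
    u≢0 = >-nonZero 1≤u
    b≢0 : NonZero b
    b≢0 = >-nonZero 1≤b
    L*L≢0 : NonZero (L * L)
    L*L≢0 = m*n≢0 L L
    L*u≢0 : NonZero (L * u)
    L*u≢0 = m*n≢0 L u
    u*u≢0 : NonZero (u * u)
    u*u≢0 = m*n≢0 u u

  w q s : ℕ
  -- Wide enough for every address: the encoding has at most 2^28 · n bits, and n < 2 ^ L.
  w = 32 * L
  q = n / b
  s = q / (L * L)

  module RRR (χ : ℕ → Bool) = Structure n w (3 * u) b (L * L) (L * u) (u * u) (2 ^ L) χ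

  kL≤w : ∀ k → k ≤ 32 → 2 ^ (k * L) ≤ 2 ^ w
  kL≤w k k≤32 = ^-monoʳ-≤ 2 (*-monoˡ-≤ L k≤32)

  n<2^w : n < 2 ^ w
  n<2^w = <-≤-trans n<2^L (≤-trans (≤-reflexive (cong (2 ^_) (sym (*-identityˡ L)))) (kL≤w 1 (s≤s z≤n)))

  0<w : 0 < w
  0<w = *-mono-≤ {1} {32} (s≤s z≤n) 1≤L

  β≤w : 3 * u ≤ w
  β≤w = *-mono-≤ {3} {32} (s≤s (s≤s (s≤s z≤n))) u≤L

  2L≤w : L + L ≤ w
  2L≤w = ≤-trans (≤-reflexive (cong (L +_) (sym (+-identityʳ L)))) (*-monoˡ-≤ L {2} {32} (s≤s (s≤s z≤n)))

  b<w : b < w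
  b<w = ≤-trans (+-mono-≤ {1} {L} 1≤L b≤L) 2L≤w

  2M≤2^w : 2 ^ L + 2 ^ L ≤ 2 ^ w
  2M≤2^w = ≤-trans (≤-reflexive (cong (2 ^ L +_) (sym (+-identityʳ (2 ^ L)))))
    (^-monoʳ-≤ 2 {suc L} (≤-trans (+-monoˡ-≤ L {1} {L} 1≤L) 2L≤w))

  L*L<2^w : L * L < 2 ^ w
  L*L<2^w = <-≤-trans (*-mono-< (n<2^n L) (n<2^n L))
    (≤-trans (≤-reflexive (sym (^-distribˡ-+-* 2 L L))) (^-monoʳ-≤ 2 2L≤w))

  -- The origin of β = 3u: a superblock has L² blocks with codes of at most b + 1 bits, and each of
  -- L, L and b + 1 is at most 2 ^ u.
  relative< : L * L * suc b < 2 ^ (3 * u)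
  relative< = begin-strict
    L * L * suc b           ≤⟨ *-monoʳ-≤ (L * L) (≤-trans (s≤s b≤L) L<2^u) ⟩
    L * L * 2 ^ u           <⟨ *-monoˡ-< (2 ^ u) {{m^n≢0 2 u}} (*-mono-< L<2^u L<2^u) ⟩
    2 ^ u * 2 ^ u * 2 ^ u   ≡⟨ cube (2 ^ u) ⟩
    (2 ^ u) ^ 3             ≡⟨ ^-*-assoc 2 u 3 ⟩
    2 ^ (u * 3)             ≡⟨ cong (2 ^_) (*-comm u 3) ⟩
    2 ^ (3 * u)             ∎
    where
    open ≤-Reasoning
    cube : ∀ x → x * x * x ≡ x * (x * (x * 1))
    cube = solve-∀

  open Overhead n L u b q s 32 1≤L 1≤u u≤L 1≤b b≤L (m/n*n≤m q (L * L)) (m/n≤m n b) public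

  X≤ : X ≤ 2 ^ 17 * n
  X≤ = begin
    n + A + D
      ≤⟨ +-mono-≤ (+-mono-≤ (≤-reflexive (sym (*-identityˡ n)))
           (A≤2^16*n (m/n*n≤m n b) 2^u≤2L (subst (λ b → L ≤ 8 * b) (sym b≡) (<⇒≤ (x<8*[1+x/8] L))))) (D≤2^14*n b≡ 2^L≤2n) ⟩
    1 * n + 2 ^ 16 * n + 2 ^ 14 * n ≡⟨ cong (_+ 2 ^ 14 * n) (*-distribʳ-+ n 1 (2 ^ 16)) ⟨
    (1 + 2 ^ 16) * n + 2 ^ 14 * n   ≡⟨ *-distribʳ-+ n (1 + 2 ^ 16) (2 ^ 14) ⟨
    (1 + 2 ^ 16 + 2 ^ 14) * n       ≤⟨ *-monoˡ-≤ n (≤ᵇ⇒≤ (1 + 2 ^ 16 + 2 ^ 14) (2 ^ 17) _) ⟩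
    2 ^ 17 * n                      ∎
    where open ≤-Reasoning

  2^11*2^17*n : 2 ^ 11 * (2 ^ 17 * n) ≡ 2 ^ 28 * n
  2^11*2^17*n = assoc (2 ^ 11) (2 ^ 17) (2 ^ 28) refl
    where
    assoc : ∀ p q r → p * q ≡ r → p * (q * n) ≡ r * n
    assoc p q .(p * q) refl = sym (*-assoc p q n)

  record AtMost (a k : ℕ) : Set where
    constructor atMost
    field scaled : a * u ≤ k * X

  open AtMost

  infixl 6 _⊕_
  _⊕_ : ∀ {a k a′ k′} → AtMost a k → AtMost a′ k′ → AtMost (a + a′) (k + k′)
  _⊕_ {a} {k} {a′} {k′} (atMost p) (atMost p′) = atMost
    (≤-trans (≤-reflexive (*-distribʳ-+ u a a′)) (≤-trans (+-mono-≤ p p′) (≤-reflexive (sym (*-distribʳ-+ X k k′)))))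

  -- The coefficients are those of Overhead with c = 32.
  segments≤ : ∀ χ → AtMost (RRR.base χ 11) 1086
  segments≤ χ =
    atMost {19 * w} {608} header≤ ⊕ atMost {(s + 2) * w} {96} super≤ ⊕ atMost {(q + 2) * (3 * u)} {9} block≤
    ⊕ atMost {(s + 2) * w} {96} super≤ ⊕ atMost {(q + 2) * (3 * u)} {9} block≤
    ⊕ atMost {suc b * 2 ^ b * b * w} {64} table≤ ⊕ atMost {suc b * 2 ^ b * b * w} {64} table≤
    ⊕ atMost {(n / (L * u) + 1) * w} {64} (group₁≤ (n / (L * u)) (m/n*n≤m n (L * u)))
    ⊕ atMost {(s + 1) * (L * u) * w} {64} explicit₁≤
    ⊕ atMost {(n / (u * u) + 1) * (3 * u)} {6} (group₂≤ (n / (u * u)) (m/n*n≤m n (u * u)))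
    ⊕ atMost {(q + 1) * (u * u) * (3 * u)} {6} explicit₂≤

  -- The sizes of all segments but the last, the stream of block codes, do not
  -- depend on χ, so any χ will do here.
  overhead : ℕ
  overhead = RRR.base (λ _ → false) 11 + (suc q + b)

  overhead≤ : AtMost overhead 1089
  overhead≤ = segments≤ (λ _ → false) ⊕ atMost {suc q + b} {3} rounding≤

  overhead*u≤ : overhead * u ≤ 2 ^ 28 * n
  overhead*u≤ = begin
    overhead * u    ≤⟨ scaled {overhead} {1089} overhead≤ ⟩
    1089 * X          ≤⟨ *-mono-≤ {1089} {2 ^ 11} (≤ᵇ⇒≤ 1089 (2 ^ 11) _) X≤ ⟩
    2 ^ 11 * (2 ^ 17 * n) ≡⟨ 2^11*2^17*n ⟩
    2 ^ 28 * n        ∎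
    where open ≤-Reasoning

  stream≤ : ∀ χ → RRR.pos χ (suc q) ≤ 4 * X
  stream≤ χ = begin
    RRR.pos χ (suc q)     ≤⟨ psum-bound (suc q) (Blocks.len≤ b χ) ⟩
    suc q * suc b           ≡⟨ expand q b ⟩
    q * b + q + b + 1       ≤⟨ +-mono-≤ (+-mono-≤ (+-mono-≤ (≤-trans (m/n*n≤m n b) n≤X) (≤-trans (m/n≤m n b) n≤X))
                                  (≤-trans b≤L (≤-trans L≤D D≤X))) (≤-trans 1≤n n≤X) ⟩
    X + X + X + X           ≡⟨ collect X ⟩
    4 * X                   ∎
    where
    open ≤-Reasoning
    expand : ∀ q b → (1 + q) * (1 + b) ≡ q * b + q + b + 1
    expand = solve-∀
    collect : ∀ X → X + X + X + X ≡ 4 * X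
    collect = solve-∀

  2^k*n<2^w : ∀ k → k < 32 → 2 ^ k * n < 2 ^ w
  2^k*n<2^w k k<32 = begin-strict
    2 ^ k * n       <⟨ *-monoʳ-< (2 ^ k) {{m^n≢0 2 k}} n<2^L ⟩
    2 ^ k * 2 ^ L   ≡⟨ ^-distribˡ-+-* 2 k L ⟨
    2 ^ (k + L)     ≤⟨ ^-monoʳ-≤ 2 (≤-trans (+-monoˡ-≤ L (m≤m*n k L)) (≤-reflexive (+-comm (k * L) L))) ⟩
    2 ^ (suc k * L) ≤⟨ kL≤w (suc k) k<32 ⟩
    2 ^ w           ∎
    where open ≤-Reasoning

  total<2^w : ∀ χ → RRR.total χ < 2 ^ w
  total<2^w χ = ≤-<-trans total≤ (2^k*n<2^w 28 (m≤m+n 29 3))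
    where
    open ≤-Reasoning
    total≤ : RRR.total χ ≤ 2 ^ 28 * n
    total≤ = begin
      RRR.base χ 11 + RRR.pos χ (suc q) * 1
        ≤⟨ +-mono-≤ (≤-trans (m≤m*n (RRR.base χ 11) u) (scaled {RRR.base χ 11} {1086} (segments≤ χ)))
                    (≤-trans (≤-reflexive (*-identityʳ (RRR.pos χ (suc q)))) (stream≤ χ)) ⟩
      1086 * X + 4 * X        ≡⟨ *-distribʳ-+ X 1086 4 ⟨
      1090 * X                ≤⟨ *-mono-≤ {1090} {2 ^ 11} (≤ᵇ⇒≤ 1090 (2 ^ 11) _) X≤ ⟩
      2 ^ 11 * (2 ^ 17 * n)   ≡⟨ 2^11*2^17*n ⟩
      2 ^ 28 * n              ∎

  parameter< : ∀ χ j → j < 8 → RRR.headerWord χ j < 2 ^ w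
  parameter< χ 0 _ = n<2^n w
  parameter< χ 1 _ = ≤-<-trans β≤w (n<2^n w)
  parameter< χ 2 _ = <-trans b<w (n<2^n w)
  parameter< χ 3 _ = L*L<2^w
  parameter< χ 4 _ = ≤-<-trans (*-monoʳ-≤ L u≤L) L*L<2^w
  parameter< χ 5 _ = ≤-<-trans (*-mono-≤ u≤L u≤L) L*L<2^w
  parameter< χ 6 _ = <-≤-trans (m<m+n (2 ^ L) (m^n>0 2 L)) 2M≤2^w
  parameter< χ 7 _ = ^-monoʳ-< 2 (s≤s (s≤s z≤n)) b<w
  parameter< χ (suc (suc (suc (suc (suc (suc (suc (suc _)))))))) (s≤s (s≤s (s≤s (s≤s (s≤s (s≤s (s≤s (s≤s ()))))))))


  add-overhead : ∀ O P m E → 2 ^ (25 * P) * m ^ (36 * m) ≤ 2 ^ (25 * (m + E)) * n ^ (36 * m) →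
                 SpaceBound n m (O + E) (O + P)
  add-overhead O P m E le = begin
    2 ^ (25 * (O + P)) * m ^ (36 * m)
      ≡⟨ cong (λ k → 2 ^ k * m ^ (36 * m)) (*-distribˡ-+ 25 O P) ⟩
    2 ^ (25 * O + 25 * P) * m ^ (36 * m)
      ≡⟨ cong (_* m ^ (36 * m)) (^-distribˡ-+-* 2 (25 * O) (25 * P)) ⟩
    2 ^ (25 * O) * 2 ^ (25 * P) * m ^ (36 * m)
      ≡⟨ *-assoc (2 ^ (25 * O)) (2 ^ (25 * P)) (m ^ (36 * m)) ⟩
    2 ^ (25 * O) * (2 ^ (25 * P) * m ^ (36 * m))
      ≤⟨ *-monoʳ-≤ (2 ^ (25 * O)) le ⟩
    2 ^ (25 * O) * (2 ^ (25 * (m + E)) * n ^ (36 * m))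
      ≡⟨ *-assoc (2 ^ (25 * O)) (2 ^ (25 * (m + E))) (n ^ (36 * m)) ⟨
    2 ^ (25 * O) * 2 ^ (25 * (m + E)) * n ^ (36 * m)
      ≡⟨ cong (_* n ^ (36 * m)) (^-distribˡ-+-* 2 (25 * O) (25 * (m + E))) ⟨
    2 ^ (25 * O + 25 * (m + E)) * n ^ (36 * m)
      ≡⟨ cong (λ k → 2 ^ k * n ^ (36 * m)) (trans (sym (*-distribˡ-+ 25 O (m + E))) (cong (25 *_) (swap O m E))) ⟩
    2 ^ (25 * (m + (O + E))) * n ^ (36 * m) ∎
    where
    open ≤-Reasoning
    swap : ∀ a b c → a + (b + c) ≡ b + (a + c)
    swap = solve-∀

  module _ (S : Subset n) where

    private
      χ = member S
      m = ∣ S ∣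

    m≤n : m ≤ n
    m≤n = ∣p∣≤n S

    count≤n : ∀ y → count χ y ≤ n
    count≤n y = ≤-trans (count-member≤ S y) m≤n

    n≤padded : n ≤ suc q * b
    n≤padded = <⇒≤ (m<[1+m/d]*d b n)

    space-bound : 1 ≤ m → SpaceBound n m overhead (length (RRR.encoding χ))
    space-bound 1≤m = subst (SpaceBound n m overhead) (sym length≡)
      (add-overhead (RRR.base χ 11) (RRR.pos χ (suc q)) m (suc q + b)
        (subst (λ k → 2 ^ (25 * RRR.pos χ (suc q)) * m ^ (36 * m) ≤ 2 ^ (25 * (m + (suc q + b))) * k ^ (36 * m)) m+d≡n
          (space (RRR.pos χ (suc q)) (suc q) b m d r r≤b 1≤m cost)))
      where
      open Cost b χ
      d r : ℕ
      d = n ∸ m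
      r = suc q * b ∸ n
      m+d≡n : m + d ≡ n
      m+d≡n = m+[n∸m]≡n m≤n
      r≤b : r ≤ b
      r≤b = m≤n+o⇒m∸n≤o (suc q * b) n (≤-trans (+-monoʳ-≤ b (m/n*n≤m n b)) (≤-reflexive (+-comm b n)))
      length≡ : length (RRR.encoding χ) ≡ RRR.base χ 11 + RRR.pos χ (suc q)
      length≡ = trans (length-applyUpTo _ (RRR.total χ)) (cong (RRR.base χ 11 +_) (*-identityʳ (RRR.pos χ (suc q))))
      ones≡m : RRR.ones χ (suc q) ≡ m
      ones≡m = trans (Blocks.ones-count b χ (suc q)) (count-member-≥ S n≤padded)
      padded≡ : suc q * b ≡ m + (d + r)
      padded≡ = trans (sym (m+[n∸m]≡n n≤padded)) (trans (cong (_+ r) (sym m+d≡n)) (+-assoc m d r))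
      zeros≡ : zeros (suc q) ≡ d + r
      zeros≡ = +-cancelˡ-≡ m (zeros (suc q)) (d + r)
        (trans (cong (_+ zeros (suc q)) (sym ones≡m)) (trans (ones+zeros (suc q)) padded≡))
      cost : ∀ x y → 2 ^ RRR.pos χ (suc q) * (x ^ m * y ^ (d + r)) ≤ 2 ^ suc q * (x + y) ^ (m + (d + r))
      cost x y = subst₂ (λ o z → 2 ^ RRR.pos χ (suc q) * (x ^ o * y ^ z) ≤ 2 ^ suc q * (x + y) ^ (m + (d + r))) ones≡m zeros≡
        (subst (λ k → 2 ^ RRR.pos χ (suc q) * (x ^ RRR.ones χ (suc q) * y ^ zeros (suc q)) ≤ 2 ^ suc q * (x + y) ^ k) padded≡
          (stream-cost (suc q) x y))

    rank-answers : ∀ (x : Fin n) TimeBound → TimeBound (length (program rankᴱ)) →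
                   Answers w (program rankᴱ) (RRR.encoding χ) (toℕ x) (rank x S) TimeBound
    rank-answers x TimeBound time = program-answers {bits = RRR.encoding χ} {TimeBound = TimeBound} rankᴱ time
      (λ μ holds → trans (evaluates (rank⇒ μ holds (toℕ<n x))) (sym (rank-count x S)))
      (≤-<-trans (≤-trans (≤-reflexive (rank-count x S)) (count≤n (suc (toℕ x)))) n<2^w)
      where
      open Evaluation
      rank⇒ : ∀ μ → Holds μ (RRR.encoding χ) → toℕ x < n → _⇒_ w μ (toℕ x) rankᴱ (count χ (suc (toℕ x)))
      rank⇒ μ holds = Correctness.rank⇒ n w (3 * u) b (L * L) (L * u) (u * u) (2 ^ L) χ
        0<w β≤w b<w n<2^L 2M≤2^w (parameter< χ) (total<2^w χ) relative< count≤n μ holds (toℕ x)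

    select-answers : ∀ (j : Fin m) TimeBound → TimeBound (length (program selectᴱ)) →
                     Answers w (program selectᴱ) (RRR.encoding χ) (suc (toℕ j)) (toℕ (select S j)) TimeBound
    select-answers j TimeBound time = program-answers {bits = RRR.encoding χ} {TimeBound = TimeBound} selectᴱ time
      (λ μ holds → trans (evaluates (select⇒ μ holds j<count)) found)
      (<-trans (toℕ<n (select S j)) n<2^w)
      where
      open Evaluation
      j<count : toℕ j < count χ n
      j<count = <-≤-trans (toℕ<n j) (≤-reflexive (size-count S))
      select⇒ : ∀ μ → Holds μ (RRR.encoding χ) → toℕ j < count χ n →
                _⇒_ w μ (suc (toℕ j)) selectᴱ (position χ (suc q * b) (toℕ j))
      select⇒ μ holds = Correctness.select⇒ n w (3 * u) b (L * L) (L * u) (u * u) (2 ^ L) χ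
        0<w β≤w b<w n<2^L 2M≤2^w (parameter< χ) (total<2^w χ) relative< count≤n μ holds (suc (toℕ j)) refl
      found : position χ (suc q * b) (toℕ j) ≡ toℕ (select S j)
      found = position-unique χ (<-≤-trans (toℕ<n (select S j)) n≤padded) (select-lower S j) (select-upper S j)

-- Instantiation for a given universe and the asymptotics

logSize logLogSize blockSize : ℕ → ℕ
logSize n    = suc ⌊log₂ n ⌋
logLogSize n = suc ⌊log₂ logSize n ⌋
blockSize n  = suc (logSize n / 8)

module Instance (n : ℕ) (1≤n : 1 ≤ n) = Parameters n (logSize n) (logLogSize n) (blockSize n) 1≤n
  (proj₂ (log₂-bounds n 1≤n)) (*-monoʳ-≤ 2 (proj₁ (log₂-bounds n 1≤n)))
  (s≤s z≤n) (proj₂ (log₂-bounds (logSize n) (s≤s z≤n)))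
  (*-monoʳ-≤ 2 (proj₁ (log₂-bounds (logSize n) (s≤s z≤n)))) (s≤s z≤n)
  (<-≤-trans (n<2^n ⌊log₂ logSize n ⌋) (proj₁ (log₂-bounds (logSize n) (s≤s z≤n))))
  (s≤s z≤n) (m/n<m (logSize n) 8 {{_}} {{_}} (s≤s (s≤s z≤n))) refl

overheadOf : ℕ → ℕ
overheadOf zero    = 0
overheadOf (suc n) = Instance.overhead (suc n) (s≤s z≤n)

encodeSet : ∀ n → Subset n → List Bool
encodeSet zero    S = List.[]
encodeSet (suc n) S = Instance.RRR.encoding (suc n) (s≤s z≤n) (member S)

-- As the overhead times `logLogSize n` is at most 2^28 · n, it suffices that `logLogSize n` reaches
-- k · 2^28; the doubly exponential threshold ensures this.
overhead-o : LittleO[n] overheadOf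
overhead-o k = 2 ^ (2 ^ (k * K)) , bound
  where
  K = 2 ^ 28
  2^-reflects-< : ∀ {i j} → 2 ^ i < 2 ^ j → i < j
  2^-reflects-< lt = ≰⇒> λ j≤i → <⇒≱ lt (^-monoʳ-≤ 2 j≤i)
  swap : ∀ a b c → a * b * c ≡ b * (a * c)
  swap = solve-∀
  scale : ∀ K e n u → .{{NonZero K}} → e * u ≤ K * n → k * K ≤ u → k * e ≤ n
  scale K e n u e*u≤ kK≤u = *-cancelʳ-≤ (k * e) n K (begin
    k * e * K   ≡⟨ swap k e K ⟩
    e * (k * K) ≤⟨ *-monoʳ-≤ e kK≤u ⟩
    e * u       ≤⟨ e*u≤ ⟩
    K * n       ≡⟨ *-comm K n ⟩
    n * K       ∎)
    where open ≤-Reasoning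
  loglog : ∀ t n → 1 ≤ n → 2 ^ (2 ^ t) ≤ n → t ≤ logLogSize n
  loglog t n 1≤n N≤n = <⇒≤ (2^-reflects-< (<-trans
    (2^-reflects-< (≤-<-trans N≤n (proj₂ (log₂-bounds n 1≤n)))) (proj₂ (log₂-bounds (logSize n) (s≤s z≤n)))))
  bound : ∀ n → 2 ^ (2 ^ (k * K)) ≤ n → k * overheadOf n ≤ n
  bound zero    N≤0 = ≤-reflexive (*-zeroʳ k)
  bound (suc n) N≤n = scale K (overheadOf (suc n)) (suc n) (logLogSize (suc n)) {{m^n≢0 2 28}}
    (Instance.overhead*u≤ (suc n) (s≤s z≤n)) (loglog (k * K) (suc n) (s≤s z≤n) N≤n)

-- Since m ≤ n, the logarithm is nonnegative and a constant bound implies the required one.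
constant-time : ∀ {n m t C} → m ≤ n → t ≤ C → QueryTimeBound C n m t
constant-time {C = C} m≤n t≤C = *-mono-≤ (^-monoʳ-≤ 2 t≤C) (^-monoˡ-≤ C m≤n)

recrank : StaticStructure
recrank = record
  { wordFactor    = 32
  ; 0<wordFactor  = s≤s z≤n
  ; encode        = encodeSet
  ; rankProgram   = program rankᴱ
  ; selectProgram = program selectᴱ
  }

queryTime : ℕ
queryTime = length (program rankᴱ) + length (program selectᴱ)

mainTheorem2 : Σ[ D ∈ StaticStructure ] Σ[ e ∈ (ℕ → ℕ) ] Σ[ C ∈ ℕ ]
    let open StaticStructure D in
    LittleO[n] e ×
    (∀ n (S : Subset n) → 1 ≤ ∣ S ∣ →
    SpaceBound n ∣ S ∣ (e n) (length (encode n S)) ×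
    (∀ (x : Fin n) →
    Answers (wordSize n) rankProgram (encode n S)
    (toℕ x) (rank x S) (QueryTimeBound C n ∣ S ∣)) ×
    (∀ (j : Fin ∣ S ∣) →
    Answers (wordSize n) selectProgram (encode n S)
    (suc (toℕ j)) (toℕ (select S j)) (QueryTimeBound C n ∣ S ∣)))
mainTheorem2 = recrank , overheadOf , queryTime , overhead-o , correct
  where
  open StaticStructure recrank
  correct : ∀ n (S : Subset n) → 1 ≤ ∣ S ∣ →
    SpaceBound n ∣ S ∣ (overheadOf n) (length (encode n S)) ×
    (∀ (x : Fin n) → Answers (wordSize n) rankProgram (encode n S)
       (toℕ x) (rank x S) (QueryTimeBound queryTime n ∣ S ∣)) ×
    (∀ (j : Fin ∣ S ∣) → Answers (wordSize n) selectProgram (encode n S)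
       (suc (toℕ j)) (toℕ (select S j)) (QueryTimeBound queryTime n ∣ S ∣))
  correct zero    Vec.[] ()
  correct (suc n) S 1≤m =
      space-bound S 1≤m
    , (λ x → rank-answers S x _ (constant-time {t = length (program rankᴱ)} {queryTime} (∣p∣≤n S)
        (m≤m+n (length (program rankᴱ)) (length (program selectᴱ)))))
    , (λ j → select-answers S j _ (constant-time {t = length (program selectᴱ)} {queryTime} (∣p∣≤n S)
        (m≤n+m (length (program selectᴱ)) (length (program rankᴱ)))))
    where open Instance (suc n) (s≤s z≤n)
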